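{- For $n\ge 2$ let $k=\lfloor\log_4(n/2)\rfloor$ and let $D_k$ be the recursive diamond graph of order $k$. There is no single-commodity hierarchical congestion approximator with approximation guarantee $o(\log n)$ on $D_k$. That is, there are a constant $c>0$ and an $n_0$ such that for all $n\ge n_0$, every hierarchical congestion approximator for $D_k$ has approximation guarantee at least $c\log n$.
   Context: The recursive diamond graph $D_k=D_k^{s,t}$ between a source $s$ and a target $t$ is defined as follows: $D_0^{s,t}$ is the single edge $\{s,t\}$. For $k\ge1$, $D_k^{s,t}$ is obtained from two new vertices $\ell,r$ and the four graphs $D_{k-1}^{s,\ell}$, $D_{k-1}^{\ell,t}$, $D_{k-1}^{s,r}$, $D_{k-1}^{r,t}$, which are disjoint except for sharing the named vertices $s,t,\ell,r$. All edges have unit capacity. For a graph $G=(V,E)$, $\mathrm{cap}(S,V\setminus S)$ is the total capacity of edges with exactly one endpoint in $S$. A demand is a function $d:V\to\mathbb{R}$ with $\sum_{v\in V}d(v)=0$; write $d(C)=\sum_{v\in C}d(v)$. A flow (antisymmetric function on $V\times V$ supported on edges) routes $d$ if its net-flow out of each $v$ equals $d(v)$; it has congestion $c$ if $|f(u,v)|\le c\cdot \mathrm{cap}(u,v)$ for all $u,v$. A (single-commodity) congestion approximator with approximation guarantee $\alpha\ge1$ is a collection $\mathcal{C}$ of subsets of $V$ such that every demand $d$ with $|d(C)|\le\mathrm{cap}(C,V\setminus C)$ for all $C\in\mathcal{C}$ can be routed in $G$ with congestion $\alpha$. It is hierarchical if $\mathcal{C}$ is a laminar family (any two members are disjoint or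 nested). -}

module Defs where

open import Data.Bool using (Bool; true; false; _∧_; _∨_; _xor_)
open import Data.Integer using (+_; -[1+_])
import Data.Integer as ℤ
import Data.Integer.Properties as ℤₚ
open import Data.List
  using (List; []; _∷_; _++_; map; foldr; length; filterᵇ; cartesianProduct; cartesianProductWith)
open import Data.List.Membership.Propositional using (_∈_)
open import Data.List.Membership.Propositional.Properties
  using (∈-map⁺; ∈-map⁻; ∈-++⁺ˡ; ∈-++⁺ʳ; ∈-cartesianProduct⁺)
open import Data.List.Relation.Unary.All using (All; []; _∷_)
open import Data.List.Relation.Unary.AllPairs using ([]; _∷_)
open import Data.List.Relation.Unary.Any using (here; there)
open import Data.List.Relation.Unary.Unique.Propositional using (Unique)
import Data.List.Relation.Unary.Unique.Propositional.Properties as Unique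
open import Data.Nat as ℕ using (ℕ; zero; suc; _⊔_; _^_; s≤s; z≤n; ⌊_/2⌋)
open import Data.Nat.Induction using (<-rec)
open import Data.Nat.Logarithm
import Data.Nat.Properties as ℕₚ
open import Data.Product using (∃; _×_; _,_; proj₁; proj₂)
open import Data.Product.Properties using (≡-dec)
open import Data.Rational as ℚ using (ℚ; 0ℚ; 1ℚ; ½; mkℚ)
import Data.Rational.Properties as ℚₚ
open import Data.Rational.Solver using (module +-*-Solver)
import Data.Rational.Unnormalised as ℚᵘ
import Data.Rational.Unnormalised.Properties as ℚᵘₚ
open import Data.Sum using (_⊎_; inj₁; inj₂)
open import Relation.Binary using (DecidableEquality)
open import Relation.Binary.PropositionalEquality
  using (_≡_; _≢_; refl; sym; trans; cong; cong₂; subst)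
open import Relation.Nullary using (¬_; yes; no; does; contradiction)

∣p∣≤q : ∀ {p q} → p ℚ.≤ q → ℚ.- p ℚ.≤ q → ℚ.∣ p ∣ ℚ.≤ q
∣p∣≤q {p} {q} p≤q -p≤q with ℚₚ.∣p∣≡p∨∣p∣≡-p p
... | inj₁ eq = subst (ℚ._≤ q) (sym eq) p≤q
... | inj₂ eq = subst (ℚ._≤ q) (sym eq) -p≤q

∣p-q∣≤ε : ∀ p q ε → p ℚ.≤ q ℚ.+ ε → q ℚ.≤ p ℚ.+ ε → ℚ.∣ p ℚ.- q ∣ ℚ.≤ ε
∣p-q∣≤ε p q ε p≤ q≤ = ∣p∣≤q
  (subst (p ℚ.- q ℚ.≤_) (cancel q ε) (ℚₚ.+-monoˡ-≤ (ℚ.- q) p≤))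
  (subst (ℚ._≤ ε) (flip p q)
    (subst (q ℚ.- p ℚ.≤_) (cancel p ε) (ℚₚ.+-monoˡ-≤ (ℚ.- p) q≤)))
  where
  open +-*-Solver
  cancel : ∀ a b → (a ℚ.+ b) ℚ.- a ≡ b
  cancel = solve 2 (λ a b → (a :+ b) :- a := b) refl
  flip : ∀ a b → b ℚ.- a ≡ ℚ.- (a ℚ.- b)
  flip = solve 2 (λ a b → b :- a := :- (a :- b)) refl

∣p∣≤∣q∣+∣p-q∣ : ∀ p q → ℚ.∣ p ∣ ℚ.≤ ℚ.∣ q ∣ ℚ.+ ℚ.∣ p ℚ.- q ∣
∣p∣≤∣q∣+∣p-q∣ p q = subst (λ r → ℚ.∣ r ∣ ℚ.≤ ℚ.∣ q ∣ ℚ.+ ℚ.∣ p ℚ.- q ∣)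
  (split p q) (ℚₚ.∣p+q∣≤∣p∣+∣q∣ q (p ℚ.- q))
  where
  open +-*-Solver
  split : ∀ a b → b ℚ.+ (a ℚ.- b) ≡ a
  split = solve 2 (λ a b → b :+ (a :- b) := a) refl

∣p-q∣≡∣q-p∣ : ∀ p q → ℚ.∣ p ℚ.- q ∣ ≡ ℚ.∣ q ℚ.- p ∣
∣p-q∣≡∣q-p∣ p q = trans (cong ℚ.∣_∣ (flip p q)) (ℚₚ.∣-p∣≡∣p∣ (q ℚ.- p))
  where
  open +-*-Solver
  flip : ∀ a b → a ℚ.- b ≡ ℚ.- (b ℚ.- a)
  flip = solve 2 (λ a b → a :- b := :- (b :- a)) refl

∣∣p∣-∣q∣∣≤∣p-q∣ : ∀ p q → ℚ.∣ ℚ.∣ p ∣ ℚ.- ℚ.∣ q ∣ ∣ ℚ.≤ ℚ.∣ p ℚ.- q ∣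
∣∣p∣-∣q∣∣≤∣p-q∣ p q = ∣p-q∣≤ε ℚ.∣ p ∣ ℚ.∣ q ∣ ℚ.∣ p ℚ.- q ∣
  (∣p∣≤∣q∣+∣p-q∣ p q)
  (subst (λ r → ℚ.∣ q ∣ ℚ.≤ ℚ.∣ p ∣ ℚ.+ r) (∣p-q∣≡∣q-p∣ q p) (∣p∣≤∣q∣+∣p-q∣ q p))

½ε+½ε≡ε : ∀ ε → ½ ℚ.* ε ℚ.+ ½ ℚ.* ε ≡ ε
½ε+½ε≡ε ε = trans (sym (ℚₚ.*-distribʳ-+ ε ½ ½)) (ℚₚ.*-identityˡ ε)

0<½ε : ∀ {ε} → 0ℚ ℚ.< ε → 0ℚ ℚ.< ½ ℚ.* ε
0<½ε {ε} 0<ε = ℚₚ.positive⁻¹ _ {{ℚₚ.pos*pos⇒pos ½ ε {{ℚ.positive 0<ε}}}}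

-- ℝ consists of Cauchy sequences of rationals; two sequences denote the same
-- real number when they are related by _≈ᴿ_.

Cauchy : (ℕ → ℚ) → Set
Cauchy x = ∀ ε → 0ℚ ℚ.< ε →
  ∃ λ N → ∀ m n → N ℕ.≤ m → N ℕ.≤ n → ℚ.∣ x m ℚ.- x n ∣ ℚ.≤ ε

record ℝ : Set where
  constructor mkℝ
  field
    seq    : ℕ → ℚ
    cauchy : Cauchy seq

open ℝ public

infix  4 _≈ᴿ_ _≤ᴿ_ _<ᴿ_
infixl 6 _+ᴿ_
infixl 7 _*ᴿ_
infix  8 -ᴿ_

_≈ᴿ_ : ℝ → ℝ → Set
x ≈ᴿ y = ∀ ε → 0ℚ ℚ.< ε → ∃ λ N → ∀ n → N ℕ.≤ n → ℚ.∣ seq x n ℚ.- seq y n ∣ ℚ.≤ ε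

_≤ᴿ_ : ℝ → ℝ → Set
x ≤ᴿ y = ∀ ε → 0ℚ ℚ.< ε → ∃ λ N → ∀ n → N ℕ.≤ n → seq x n ℚ.≤ seq y n ℚ.+ ε

_<ᴿ_ : ℝ → ℝ → Set
x <ᴿ y = ∃ λ ε → 0ℚ ℚ.< ε × ∃ λ N → ∀ n → N ℕ.≤ n → seq x n ℚ.+ ε ℚ.≤ seq y n

const-cauchy : ∀ q → Cauchy (λ _ → q)
const-cauchy q ε 0<ε = 0 , λ _ _ _ _ →
  subst (ℚ._≤ ε) (sym (cong ℚ.∣_∣ (ℚₚ.+-inverseʳ q))) (ℚₚ.<⇒≤ 0<ε)

fromℚ : ℚ → ℝ
fromℚ q = mkℝ (λ _ → q) (const-cauchy q)

fromℕ : ℕ → ℝ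
fromℕ n = fromℚ (+ n ℚ./ 1)

0ᴿ 1ᴿ : ℝ
0ᴿ = fromℚ 0ℚ
1ᴿ = fromℚ 1ℚ

+-cauchy : ∀ x y → Cauchy x → Cauchy y → Cauchy (λ n → x n ℚ.+ y n)
+-cauchy x y cx cy ε 0<ε with cx (½ ℚ.* ε) (0<½ε 0<ε) | cy (½ ℚ.* ε) (0<½ε 0<ε)
... | M , p | N , q = M ⊔ N , λ m n m≥ n≥ → begin
  ℚ.∣ (x m ℚ.+ y m) ℚ.- (x n ℚ.+ y n) ∣
    ≡⟨ cong ℚ.∣_∣ (rearrange (x m) (y m) (x n) (y n)) ⟩
  ℚ.∣ (x m ℚ.- x n) ℚ.+ (y m ℚ.- y n) ∣
    ≤⟨ ℚₚ.∣p+q∣≤∣p∣+∣q∣ (x m ℚ.- x n) (y m ℚ.- y n) ⟩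
  ℚ.∣ x m ℚ.- x n ∣ ℚ.+ ℚ.∣ y m ℚ.- y n ∣
    ≤⟨ ℚₚ.+-mono-≤
         (p m n (ℕₚ.m⊔n≤o⇒m≤o M N m≥) (ℕₚ.m⊔n≤o⇒m≤o M N n≥))
         (q m n (ℕₚ.m⊔n≤o⇒n≤o M N m≥) (ℕₚ.m⊔n≤o⇒n≤o M N n≥)) ⟩
  ½ ℚ.* ε ℚ.+ ½ ℚ.* ε
    ≡⟨ ½ε+½ε≡ε ε ⟩
  ε ∎
  where
  open ℚₚ.≤-Reasoning
  open +-*-Solver
  rearrange : ∀ a b c d → (a ℚ.+ b) ℚ.- (c ℚ.+ d) ≡ (a ℚ.- c) ℚ.+ (b ℚ.- d)
  rearrange = solve 4 (λ a b c d → (a :+ b) :- (c :+ d) := (a :- c) :+ (b :- d)) refl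

_+ᴿ_ : ℝ → ℝ → ℝ
x +ᴿ y = mkℝ (λ n → seq x n ℚ.+ seq y n) (+-cauchy (seq x) (seq y) (cauchy x) (cauchy y))

neg-cauchy : ∀ x → Cauchy x → Cauchy (λ n → ℚ.- x n)
neg-cauchy x cx ε 0<ε with cx ε 0<ε
... | N , p = N , λ m n m≥ n≥ → subst (ℚ._≤ ε)
  (trans (∣p-q∣≡∣q-p∣ (x m) (x n)) (cong ℚ.∣_∣ (rearrange (x m) (x n)))) (p m n m≥ n≥)
  where
  open +-*-Solver
  rearrange : ∀ a b → b ℚ.- a ≡ (ℚ.- a) ℚ.- (ℚ.- b)
  rearrange = solve 2 (λ a b → b :- a := (:- a) :- (:- b)) refl

-ᴿ_ : ℝ → ℝ
-ᴿ x = mkℝ (λ n → ℚ.- seq x n) (neg-cauchy (seq x) (cauchy x))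

abs-cauchy : ∀ x → Cauchy x → Cauchy (λ n → ℚ.∣ x n ∣)
abs-cauchy x cx ε 0<ε with cx ε 0<ε
... | N , p = N , λ m n m≥ n≥ →
  ℚₚ.≤-trans (∣∣p∣-∣q∣∣≤∣p-q∣ (x m) (x n)) (p m n m≥ n≥)

∣_∣ᴿ : ℝ → ℝ
∣ x ∣ᴿ = mkℝ (λ n → ℚ.∣ seq x n ∣) (abs-cauchy (seq x) (cauchy x))

cauchy⇒bounded : ∀ x → Cauchy x →
  ∃ λ B → ℚ.Positive B × ∃ λ N → ∀ n → N ℕ.≤ n → ℚ.∣ x n ∣ ℚ.≤ B
cauchy⇒bounded x cx with cx 1ℚ (ℚₚ.positive⁻¹ 1ℚ)
... | N , p =
    ℚ.∣ x N ∣ ℚ.+ 1ℚ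
  , ℚₚ.nonNeg+pos⇒pos ℚ.∣ x N ∣ {{ℚₚ.∣-∣-nonNeg (x N)}} 1ℚ
  , N
  , λ n n≥ → ℚₚ.≤-trans (∣p∣≤∣q∣+∣p-q∣ (x n) (x N))
               (ℚₚ.+-monoʳ-≤ ℚ.∣ x N ∣ (p n N n≥ ℕₚ.≤-refl))

scaled : ∀ B → ℚ.Positive B → ∀ ε → 0ℚ ℚ.< ε →
  ∃ λ δ → 0ℚ ℚ.< δ × B ℚ.* δ ≡ ε
scaled B posB ε 0<ε =
    1/B ℚ.* ε
  , ℚₚ.positive⁻¹ _ {{ℚₚ.pos*pos⇒pos 1/B {{ℚₚ.1/pos⇒pos B}} ε {{ℚ.positive 0<ε}}}}
  , trans (sym (ℚₚ.*-assoc B 1/B ε))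
      (trans (cong (ℚ._* ε) (ℚₚ.*-inverseʳ B)) (ℚₚ.*-identityˡ ε))
  where
  instance
    B>0 : ℚ.Positive B
    B>0 = posB
    B≢0 : ℚ.NonZero B
    B≢0 = ℚₚ.pos⇒nonZero B
  1/B : ℚ
  1/B = ℚ.1/ B

∣a*b∣≤A*B : ∀ a b A B → ℚ.Positive A → ℚ.∣ a ∣ ℚ.≤ A → ℚ.∣ b ∣ ℚ.≤ B →
  ℚ.∣ a ℚ.* b ∣ ℚ.≤ A ℚ.* B
∣a*b∣≤A*B a b A B posA a≤A b≤B = begin
  ℚ.∣ a ℚ.* b ∣
    ≡⟨ ℚₚ.∣p*q∣≡∣p∣*∣q∣ a b ⟩
  ℚ.∣ a ∣ ℚ.* ℚ.∣ b ∣
    ≤⟨ ℚₚ.*-monoʳ-≤-nonNeg ℚ.∣ b ∣ {{ℚₚ.∣-∣-nonNeg b}} a≤A ⟩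
  A ℚ.* ℚ.∣ b ∣
    ≤⟨ ℚₚ.*-monoˡ-≤-nonNeg A {{ℚₚ.pos⇒nonNeg A {{posA}}}} b≤B ⟩
  A ℚ.* B ∎
  where open ℚₚ.≤-Reasoning

∣ab-cd∣≤Aδ+Bη : ∀ a b c d A B δ η → ℚ.Positive A → ℚ.Positive B →
  ℚ.∣ a ∣ ℚ.≤ A → ℚ.∣ d ∣ ℚ.≤ B → ℚ.∣ b ℚ.- d ∣ ℚ.≤ δ → ℚ.∣ a ℚ.- c ∣ ℚ.≤ η →
  ℚ.∣ a ℚ.* b ℚ.- c ℚ.* d ∣ ℚ.≤ A ℚ.* δ ℚ.+ B ℚ.* η
∣ab-cd∣≤Aδ+Bη a b c d A B δ η posA posB a≤ d≤ b-d≤ a-c≤ = begin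
  ℚ.∣ a ℚ.* b ℚ.- c ℚ.* d ∣
    ≡⟨ cong ℚ.∣_∣ (rearrange a b c d) ⟩
  ℚ.∣ a ℚ.* (b ℚ.- d) ℚ.+ d ℚ.* (a ℚ.- c) ∣
    ≤⟨ ℚₚ.∣p+q∣≤∣p∣+∣q∣ (a ℚ.* (b ℚ.- d)) (d ℚ.* (a ℚ.- c)) ⟩
  ℚ.∣ a ℚ.* (b ℚ.- d) ∣ ℚ.+ ℚ.∣ d ℚ.* (a ℚ.- c) ∣
    ≤⟨ ℚₚ.+-mono-≤ (∣a*b∣≤A*B a (b ℚ.- d) A δ posA a≤ b-d≤)
                   (∣a*b∣≤A*B d (a ℚ.- c) B η posB d≤ a-c≤) ⟩
  A ℚ.* δ ℚ.+ B ℚ.* η ∎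
  where
  open ℚₚ.≤-Reasoning
  rearrange : ∀ a b c d →
    a ℚ.* b ℚ.- c ℚ.* d ≡ a ℚ.* (b ℚ.- d) ℚ.+ d ℚ.* (a ℚ.- c)
  rearrange = solve 4 (λ a b c d →
    a :* b :- c :* d := a :* (b :- d) :+ d :* (a :- c)) refl
    where open +-*-Solver

*-cauchy : ∀ x y → Cauchy x → Cauchy y → Cauchy (λ n → x n ℚ.* y n)
*-cauchy x y cx cy ε 0<ε = modulus (cauchy⇒bounded x cx) (cauchy⇒bounded y cy)
  where
  Bound : (ℕ → ℚ) → Set
  Bound z = ∃ λ B → ℚ.Positive B × ∃ λ N → ∀ n → N ℕ.≤ n → ℚ.∣ z n ∣ ℚ.≤ B

  modulus : Bound x → Bound y →
    ∃ λ N → ∀ m n → N ℕ.≤ m → N ℕ.≤ n → ℚ.∣ x m ℚ.* y m ℚ.- x n ℚ.* y n ∣ ℚ.≤ ε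
  modulus (A , posA , K , bx) (B , posB , L , by) =
    (K ⊔ L) ⊔ (M ⊔ N) , λ m n m≥ n≥ →
    let m≥KL = ℕₚ.m⊔n≤o⇒m≤o (K ⊔ L) (M ⊔ N) m≥
        m≥MN = ℕₚ.m⊔n≤o⇒n≤o (K ⊔ L) (M ⊔ N) m≥
        n≥KL = ℕₚ.m⊔n≤o⇒m≤o (K ⊔ L) (M ⊔ N) n≥
        n≥MN = ℕₚ.m⊔n≤o⇒n≤o (K ⊔ L) (M ⊔ N) n≥
    in subst (ℚ.∣ x m ℚ.* y m ℚ.- x n ℚ.* y n ∣ ℚ.≤_)
      (trans (cong₂ ℚ._+_ Aδ≡ Bη≡) (½ε+½ε≡ε ε))
      (∣ab-cd∣≤Aδ+Bη (x m) (y m) (x n) (y n) A B δ η posA posB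
        (bx m (ℕₚ.m⊔n≤o⇒m≤o K L m≥KL)) (by n (ℕₚ.m⊔n≤o⇒n≤o K L n≥KL))
        (q m n (ℕₚ.m⊔n≤o⇒m≤o M N m≥MN) (ℕₚ.m⊔n≤o⇒m≤o M N n≥MN))
        (p m n (ℕₚ.m⊔n≤o⇒n≤o M N m≥MN) (ℕₚ.m⊔n≤o⇒n≤o M N n≥MN)))
    where
    sδ = scaled A posA (½ ℚ.* ε) (0<½ε 0<ε)
    sη = scaled B posB (½ ℚ.* ε) (0<½ε 0<ε)
    δ = proj₁ sδ
    η = proj₁ sη
    Aδ≡ = proj₂ (proj₂ sδ)
    Bη≡ = proj₂ (proj₂ sη)
    cyδ = cy δ (proj₁ (proj₂ sδ))
    cxη = cx η (proj₁ (proj₂ sη))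
    M = proj₁ cyδ
    N = proj₁ cxη
    q = proj₂ cyδ
    p = proj₂ cxη

_*ᴿ_ : ℝ → ℝ → ℝ
x *ᴿ y = mkℝ (λ n → seq x n ℚ.* seq y n) (*-cauchy (seq x) (seq y) (cauchy x) (cauchy y))

1≤⌊2+n/2⌋ : ∀ n → 1 ℕ.≤ ⌊ suc (suc n) /2⌋
1≤⌊2+n/2⌋ n = s≤s z≤n

2*⌊n/2⌋≤n : ∀ n → 2 ℕ.* ⌊ n /2⌋ ℕ.≤ n
2*⌊n/2⌋≤n n = ℕₚ.≤-trans
  (ℕₚ.≤-reflexive (cong (⌊ n /2⌋ ℕ.+_) (ℕₚ.+-identityʳ ⌊ n /2⌋)))
  (ℕₚ.≤-trans (ℕₚ.+-monoʳ-≤ ⌊ n /2⌋ (ℕₚ.⌊n/2⌋≤⌈n/2⌉ n))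
    (ℕₚ.≤-reflexive (ℕₚ.⌊n/2⌋+⌈n/2⌉≡n n)))

2^⌊log₂n⌋≤n : ∀ n → 1 ℕ.≤ n → 2 ^ ⌊log₂ n ⌋ ℕ.≤ n
2^⌊log₂n⌋≤n = <-rec _ step
  where
  step : ∀ n → (∀ {m} → m ℕ.< n → 1 ℕ.≤ m → 2 ^ ⌊log₂ m ⌋ ℕ.≤ m) →
         1 ℕ.≤ n → 2 ^ ⌊log₂ n ⌋ ℕ.≤ n
  step (suc zero) _ _ = ℕₚ.≤-refl
  step n@(suc (suc m)) rec _ = begin
    2 ^ ⌊log₂ n ⌋                 ≡⟨ cong (2 ^_) log-eq ⟩
    2 ℕ.* 2 ^ ⌊log₂ ⌊ n /2⌋ ⌋     ≤⟨ ℕₚ.*-monoʳ-≤ 2 (rec (ℕₚ.⌊n/2⌋<n (suc m)) (1≤⌊2+n/2⌋ m)) ⟩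
    2 ℕ.* ⌊ n /2⌋                 ≤⟨ 2*⌊n/2⌋≤n n ⟩
    n                             ∎
    where
    open ℕₚ.≤-Reasoning
    log-eq : ⌊log₂ n ⌋ ≡ suc ⌊log₂ ⌊ n /2⌋ ⌋
    log-eq = sym (trans (cong suc (⌊log₂⌊n/2⌋⌋≡⌊log₂n⌋∸1 n))
      (ℕₚ.m+[n∸m]≡n {1} (⌊log₂⌋-mono-≤ {2} {n} (s≤s (s≤s z≤n)))))

n<2^1+⌊log₂n⌋ : ∀ n → n ℕ.< 2 ^ suc ⌊log₂ n ⌋
n<2^1+⌊log₂n⌋ n with n ℕ.<? 2 ^ suc ⌊log₂ n ⌋
... | yes p = p
... | no ¬p = contradiction
  (subst (ℕ._≤ ⌊log₂ n ⌋) (⌊log₂[2^n]⌋≡n (suc ⌊log₂ n ⌋)) (⌊log₂⌋-mono-≤ (ℕₚ.≮⇒≥ ¬p)))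
  (ℕₚ.<⇒≱ (ℕₚ.n<1+n ⌊log₂ n ⌋))

-- The m-th term, ⌊log₂ n^(m+1)⌋ / (m+1), is within 1/(m+1) of log₂ n when n ≥ 1.
log₂-seq : ℕ → ℕ → ℚ
log₂-seq n m = + ⌊log₂ (n ^ suc m) ⌋ ℚ./ suc m

log₂-cross : ∀ n p q .{{_ : ℕ.NonZero p}} → 1 ℕ.≤ n →
  ⌊log₂ (n ^ p) ⌋ ℕ.* q ℕ.≤ suc ⌊log₂ (n ^ q) ⌋ ℕ.* p
log₂-cross n p q 1≤n with ⌊log₂ (n ^ p) ⌋ ℕ.* q ℕ.≤? suc ⌊log₂ (n ^ q) ⌋ ℕ.* p
... | yes h = h
... | no ¬h = contradiction chain (ℕₚ.<-irrefl refl)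
  where
  open ℕₚ.≤-Reasoning
  a = ⌊log₂ (n ^ p) ⌋
  b = ⌊log₂ (n ^ q) ⌋
  chain : n ^ (p ℕ.* q) ℕ.< n ^ (p ℕ.* q)
  chain = begin-strict
    n ^ (p ℕ.* q)       ≡⟨ cong (n ^_) (ℕₚ.*-comm p q) ⟩
    n ^ (q ℕ.* p)       ≡⟨ ℕₚ.^-*-assoc n q p ⟨
    (n ^ q) ^ p         <⟨ ℕₚ.^-monoˡ-< p (n<2^1+⌊log₂n⌋ (n ^ q)) ⟩
    (2 ^ suc b) ^ p     ≡⟨ ℕₚ.^-*-assoc 2 (suc b) p ⟩
    2 ^ (suc b ℕ.* p)   ≤⟨ ℕₚ.^-monoʳ-≤ 2 (ℕₚ.<⇒≤ (ℕₚ.≰⇒> ¬h)) ⟩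
    2 ^ (a ℕ.* q)       ≡⟨ ℕₚ.^-*-assoc 2 a q ⟨
    (2 ^ a) ^ q         ≤⟨ ℕₚ.^-monoˡ-≤ q (2^⌊log₂n⌋≤n (n ^ p) (ℕₚ.m^n>0 n {{ℕ.>-nonZero 1≤n}} p)) ⟩
    (n ^ p) ^ q         ≡⟨ ℕₚ.^-*-assoc n p q ⟩
    n ^ (p ℕ.* q)       ∎

toℚᵘ-/ : ∀ a m → ℚ.toℚᵘ (+ a ℚ./ suc m) ℚᵘ.≃ ℚᵘ.mkℚᵘ (+ a) m
toℚᵘ-/ a m = ℚₚ.toℚᵘ-fromℚᵘ (ℚᵘ.mkℚᵘ (+ a) m)

/-mono : ∀ a b p q → a ℕ.* suc q ℕ.≤ b ℕ.* suc p → (+ a ℚ./ suc p) ℚ.≤ (+ b ℚ./ suc q)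
/-mono a b p q h = ℚₚ.toℚᵘ-cancel-≤
  (ℚᵘₚ.≤-respˡ-≃ (ℚᵘₚ.≃-sym (toℚᵘ-/ a p))
    (ℚᵘₚ.≤-respʳ-≃ (ℚᵘₚ.≃-sym (toℚᵘ-/ b q))
      (ℚᵘ.*≤* (subst₂′ (ℤₚ.pos-* a (suc q)) (ℤₚ.pos-* b (suc p)) (ℤ.+≤+ h)))))
  where
  subst₂′ : ∀ {i j k l} → i ≡ k → j ≡ l → i ℤ.≤ j → k ℤ.≤ l
  subst₂′ refl refl r = r

suc-/ : ∀ b q → (+ suc b ℚ./ suc q) ≡ (+ b ℚ./ suc q) ℚ.+ (+ 1 ℚ./ suc q)
suc-/ b q = ℚₚ.toℚᵘ-injective (begin-equality
  ℚ.toℚᵘ (+ suc b ℚ./ suc q)                                ≃⟨ toℚᵘ-/ (suc b) q ⟩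
  ℚᵘ.mkℚᵘ (+ suc b) q                                       ≃⟨ ℚᵘ.*≡* cross ⟩
  ℚᵘ.mkℚᵘ (+ b) q ℚᵘ.+ ℚᵘ.mkℚᵘ (+ 1) q                      ≃⟨ ℚᵘₚ.+-cong (toℚᵘ-/ b q) (toℚᵘ-/ 1 q) ⟨
  ℚ.toℚᵘ (+ b ℚ./ suc q) ℚᵘ.+ ℚ.toℚᵘ (+ 1 ℚ./ suc q)        ≃⟨ ℚₚ.toℚᵘ-homo-+ (+ b ℚ./ suc q) (+ 1 ℚ./ suc q) ⟨
  ℚ.toℚᵘ ((+ b ℚ./ suc q) ℚ.+ (+ 1 ℚ./ suc q))              ∎)
  where
  open ℚᵘₚ.≤-Reasoning
  cross : + suc b ℤ.* (+ suc q ℤ.* + suc q) ≡ (+ b ℤ.* + suc q ℤ.+ + 1 ℤ.* + suc q) ℤ.* + suc q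
  cross = trans (sym (ℤₚ.*-assoc (+ suc b) (+ suc q) (+ suc q)))
    (cong (ℤ._* + suc q) (trans (cong (ℤ._* + suc q) (cong (+_) (ℕₚ.+-comm 1 b)))
      (ℤₚ.*-distribʳ-+ (+ suc q) (+ b) (+ 1))))

log₂-close : ∀ n p q → 1 ℕ.≤ n → log₂-seq n p ℚ.≤ log₂-seq n q ℚ.+ (+ 1 ℚ./ suc q)
log₂-close n p q 1≤n = subst (log₂-seq n p ℚ.≤_) (suc-/ ⌊log₂ (n ^ suc q) ⌋ q)
  (/-mono ⌊log₂ (n ^ suc p) ⌋ (suc ⌊log₂ (n ^ suc q) ⌋) p q (log₂-cross n (suc p) (suc q) 1≤n))

archimedean : ∀ ε → 0ℚ ℚ.< ε → ∃ λ N → ∀ n → N ℕ.≤ n → (+ 1 ℚ./ suc n) ℚ.≤ ε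
archimedean (mkℚ (+ zero) d c) (ℚ.*<* (ℤ.+<+ ()))
archimedean ε@(mkℚ (+ suc a) d c) _ = d , λ n n≥ →
  subst ((+ 1 ℚ./ suc n) ℚ.≤_) (ℚₚ.fromℚᵘ-toℚᵘ ε)
    (/-mono 1 (suc a) n d (ℕₚ.≤-trans (ℕₚ.≤-reflexive (ℕₚ.*-identityˡ (suc d)))
      (ℕₚ.≤-trans (s≤s n≥) (ℕₚ.m≤n*m (suc n) (suc a)))))
archimedean (mkℚ -[1+ a ] d c) (ℚ.*<* ())

0/[1+m]≡0 : ∀ m → (+ 0 ℚ./ suc m) ≡ 0ℚ
0/[1+m]≡0 m = ℚₚ.fromℚᵘ-cong {ℚᵘ.mkℚᵘ (+ 0) m} {ℚᵘ.0ℚᵘ} (ℚᵘ.*≡* refl)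

log₂-cauchy : ∀ n → Cauchy (log₂-seq n)
log₂-cauchy zero ε 0<ε = 0 , λ p q _ _ → ℚₚ.≤-trans
  (ℚₚ.≤-reflexive (cong ℚ.∣_∣ (cong₂ ℚ._-_ (0/[1+m]≡0 p) (0/[1+m]≡0 q)))) (ℚₚ.<⇒≤ 0<ε)
log₂-cauchy n@(suc _) ε 0<ε = proj₁ arch , λ p q p≥ q≥ →
  ∣p-q∣≤ε (log₂-seq n p) (log₂-seq n q) ε
    (ℚₚ.≤-trans (log₂-close n p q (s≤s z≤n))
      (ℚₚ.+-monoʳ-≤ (log₂-seq n q) (proj₂ arch q q≥)))
    (ℚₚ.≤-trans (log₂-close n q p (s≤s z≤n))
      (ℚₚ.+-monoʳ-≤ (log₂-seq n p) (proj₂ arch p p≥)))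
  where
  arch : ∃ λ N → ∀ n → N ℕ.≤ n → (+ 1 ℚ./ suc n) ℚ.≤ ε
  arch = archimedean ε 0<ε

-- log₂ 0 takes the value 0.
log₂ : ℕ → ℝ
log₂ n = mkℝ (log₂-seq n) (log₂-cauchy n)

record Graph : Set₁ where
  field
    V        : Set
    _≟_      : DecidableEquality V
    vertices : List V
    complete : ∀ v → v ∈ vertices
    unique   : Unique vertices
    -- Every undirected edge is listed once, in an arbitrary orientation;
    -- repeated entries would be parallel edges.
    edges    : List (V × V)

module _ (G : Graph) where
  open Graph G

  Subset : Set
  Subset = V → Bool

  Adjacent : V → V → Set
  Adjacent u v = (u , v) ∈ edges ⊎ (v , u) ∈ edges

  joins : V → V → V × V → Bool
  joins u v (a , b) = (does (u ≟ a) ∧ does (v ≟ b)) ∨ (does (u ≟ b) ∧ does (v ≟ a))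

  cap : V → V → ℕ
  cap u v = length (filterᵇ (joins u v) edges)

  crosses : Subset → V × V → Bool
  crosses S (a , b) = S a xor S b

  cut : Subset → ℕ
  cut S = length (filterᵇ (crosses S) edges)

  ∑ : List V → (V → ℝ) → ℝ
  ∑ vs g = foldr _+ᴿ_ 0ᴿ (map g vs)

  total : (V → ℝ) → Subset → ℝ
  total d C = ∑ (filterᵇ C vertices) d

  IsDemand : (V → ℝ) → Set
  IsDemand d = ∑ vertices d ≈ᴿ 0ᴿ

  Antisymmetric : (V → V → ℝ) → Set
  Antisymmetric f = ∀ u v → f u v ≈ᴿ -ᴿ f v u

  SupportedOnEdges : (V → V → ℝ) → Set
  SupportedOnEdges f = ∀ u v → ¬ Adjacent u v → f u v ≈ᴿ 0ᴿ

  IsFlow : (V → V → ℝ) → Set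
  IsFlow f = Antisymmetric f × SupportedOnEdges f

  Routes : (V → V → ℝ) → (V → ℝ) → Set
  Routes f d = ∀ v → ∑ vertices (f v) ≈ᴿ d v

  HasCongestion : (V → V → ℝ) → ℝ → Set
  HasCongestion f c = ∀ u v → ∣ f u v ∣ᴿ ≤ᴿ c *ᴿ fromℕ (cap u v)

  Routable : (V → ℝ) → ℝ → Set
  Routable d c = ∃ λ f → IsFlow f × Routes f d × HasCongestion f c

  RespectsCuts : List Subset → (V → ℝ) → Set
  RespectsCuts 𝒞 d = ∀ {C} → C ∈ 𝒞 → ∣ total d C ∣ᴿ ≤ᴿ fromℕ (cut C)

  IsCongestionApproximator : List Subset → ℝ → Set
  IsCongestionApproximator 𝒞 α =
    1ᴿ ≤ᴿ α × (∀ d → IsDemand d → RespectsCuts 𝒞 d → Routable d α)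

  _⊑_ : Subset → Subset → Set
  A ⊑ B = ∀ v → A v ≡ true → B v ≡ true

  Disjoint : Subset → Subset → Set
  Disjoint A B = ∀ v → A v ≡ true → B v ≡ false

  Laminar : List Subset → Set
  Laminar 𝒞 = ∀ {A B} → A ∈ 𝒞 → B ∈ 𝒞 → Disjoint A B ⊎ A ⊑ B ⊎ B ⊑ A

data Side : Set where
  left right : Side

data Half : Set where
  near far : Half

-- Vertices of D k other than the terminals.  For k ≥ 1 they are the two
-- middle vertices ℓ = mid left and r = mid right, and the non-terminal
-- vertices of the four copies of D (k - 1): copy (left , near) runs from s
-- to ℓ, copy (left , far) from ℓ to t, and likewise on the right.
data Inner : ℕ → Set where
  mid  : ∀ {k} → Side → Inner (suc k)
  copy : ∀ {k} → Side × Half → Inner k → Inner (suc k)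

data Vertex (k : ℕ) : Set where
  s t   : Vertex k
  inner : Inner k → Vertex k

place : ∀ {k} → Side × Half → Vertex k → Vertex (suc k)
place (_ , near) s         = s
place (a , near) t         = inner (mid a)
place (a , far)  s         = inner (mid a)
place (_ , far)  t         = t
place q          (inner v) = inner (copy q v)

sides : List Side
sides = left ∷ right ∷ []

halves : List Half
halves = near ∷ far ∷ []

quarters : List (Side × Half)
quarters = cartesianProduct sides halves

diamondEdges : ∀ k → List (Vertex k × Vertex k)
diamondEdges zero    = (s , t) ∷ []
diamondEdges (suc k) =
  cartesianProductWith (λ { q (u , v) → place q u , place q v }) quarters (diamondEdges k)

inners : ∀ k → List (Inner k)
inners zero    = []
inners (suc k) =
  map mid sides ++ map (λ { (q , v) → copy q v }) (cartesianProduct quarters (inners k))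

diamondVertices : ∀ k → List (Vertex k)
diamondVertices k = s ∷ t ∷ map inner (inners k)

_≟ˢ_ : DecidableEquality Side
left  ≟ˢ left  = yes refl
left  ≟ˢ right = no λ ()
right ≟ˢ left  = no λ ()
right ≟ˢ right = yes refl

_≟ʰ_ : DecidableEquality Half
near ≟ʰ near = yes refl
near ≟ʰ far  = no λ ()
far  ≟ʰ near = no λ ()
far  ≟ʰ far  = yes refl

_≟ⁱ_ : ∀ {k} → DecidableEquality (Inner k)
mid a ≟ⁱ mid b with a ≟ˢ b
... | yes refl = yes refl
... | no a≢b   = no λ { refl → a≢b refl }
mid _ ≟ⁱ copy _ _ = no λ ()
copy _ _ ≟ⁱ mid _ = no λ ()
copy p u ≟ⁱ copy q v with ≡-dec _≟ˢ_ _≟ʰ_ p q | u ≟ⁱ v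
... | yes refl | yes refl = yes refl
... | yes _    | no u≢v   = no λ { refl → u≢v refl }
... | no p≢q   | _        = no λ { refl → p≢q refl }

_≟ᵛ_ : ∀ {k} → DecidableEquality (Vertex k)
s ≟ᵛ s = yes refl
s ≟ᵛ t = no λ ()
s ≟ᵛ inner _ = no λ ()
t ≟ᵛ s = no λ ()
t ≟ᵛ t = yes refl
t ≟ᵛ inner _ = no λ ()
inner _ ≟ᵛ s = no λ ()
inner _ ≟ᵛ t = no λ ()
inner u ≟ᵛ inner v with u ≟ⁱ v
... | yes refl = yes refl
... | no u≢v   = no λ { refl → u≢v refl }

sides-complete : ∀ a → a ∈ sides
sides-complete left  = here refl
sides-complete right = there (here refl)

quarters-complete : ∀ q → q ∈ quarters
quarters-complete (a , near) = ∈-cartesianProduct⁺ {xs = sides} {ys = halves} (sides-complete a) (here refl)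
quarters-complete (a , far)  = ∈-cartesianProduct⁺ {xs = sides} {ys = halves} (sides-complete a) (there (here refl))

inners-complete : ∀ {k} (v : Inner k) → v ∈ inners k
inners-complete (mid a)    = ∈-++⁺ˡ (∈-map⁺ mid (sides-complete a))
inners-complete (copy q v) = ∈-++⁺ʳ (map mid sides)
  (∈-map⁺ _ (∈-cartesianProduct⁺ (quarters-complete q) (inners-complete v)))

diamondVertices-complete : ∀ {k} (v : Vertex k) → v ∈ diamondVertices k
diamondVertices-complete s         = here refl
diamondVertices-complete t         = there (here refl)
diamondVertices-complete (inner v) = there (there (∈-map⁺ inner (inners-complete v)))

sides-unique : Unique sides
sides-unique = ((λ ()) ∷ []) ∷ [] ∷ []

quarters-unique : Unique quarters
quarters-unique = Unique.cartesianProduct⁺ sides-unique (((λ ()) ∷ []) ∷ [] ∷ [])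

inners-unique : ∀ k → Unique (inners k)
inners-unique zero    = []
inners-unique (suc k) = Unique.++⁺
  (Unique.map⁺ {f = mid} (λ { refl → refl }) sides-unique)
  (Unique.map⁺ (λ { refl → refl }) (Unique.cartesianProduct⁺ quarters-unique (inners-unique k)))
  (λ { (x∈ , y∈) → disjoint (∈-map⁻ mid x∈) (∈-map⁻ _ y∈) })
  where
  disjoint : ∀ {v : Inner (suc k)} →
    (∃ λ a → a ∈ sides × v ≡ mid a) →
    ¬ (∃ λ (p : (Side × Half) × Inner k) →
         p ∈ cartesianProduct quarters (inners k) × v ≡ copy (proj₁ p) (proj₂ p))
  disjoint (_ , _ , refl) (_ , _ , ())

diamondVertices-unique : ∀ k → Unique (diamondVertices k)
diamondVertices-unique k =
  ((λ ()) ∷ all-inner≢ (λ ()) (inners k)) ∷ (all-inner≢ (λ ()) (inners k))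
    ∷ Unique.map⁺ (λ { refl → refl }) (inners-unique k)
  where
  all-inner≢ : ∀ {x : Vertex k} → (∀ {v} → x ≢ inner v) → ∀ vs → All (x ≢_) (map inner vs)
  all-inner≢ x≢ []       = []
  all-inner≢ x≢ (v ∷ vs) = x≢ ∷ all-inner≢ x≢ vs

D : ℕ → Graph
D k = record
  { V        = Vertex k
  ; _≟_      = _≟ᵛ_
  ; vertices = diamondVertices k
  ; complete = diamondVertices-complete
  ; unique   = diamondVertices-unique k
  ; edges    = diamondEdges k
  }

-- k = ⌊log₄ (n / 2)⌋, that is, 4 ^ k ≤ n / 2 < 4 ^ (k + 1).
IsFloorLog₄Half : ℕ → ℕ → Set
IsFloorLog₄Half n k = 2 ℕ.* 4 ^ k ℕ.≤ n × n ℕ.< 2 ℕ.* 4 ^ suc k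

{-# OPTIONS --safe #-}
module Submission where

-- Read as a tree, a laminar family 𝒞 sends each edge of D k along a tree path
-- that loads a member C exactly when the edge crosses C.  For the four corners
-- s, ℓ, t, r of a diamond, the tree paths s–ℓ and r–t meet or the paths s–r
-- and ℓ–t meet.  Say the first: then the 2^(k-1) edge-disjoint routes through
-- the copy s–ℓ and through the copy r–t can be matched so that each matched
-- pair of routes contains edges e and e′ whose tree paths meet.  A unit of
-- demand from an end of e to an end of e′ loads 𝒞 no more than e and e′ do.
-- The cut that separates these two copies and continues recursively inside the
-- other two copies, whose edges are still unused, has capacity 2^k but is
-- crossed by 2^(k-1) units of demand per level.  So the guarantee is at least
-- k / 2.

open import Defs
open import Data.Bool using (Bool; true; false; not; _xor_; _∧_; _∨_; if_then_else_)
open import Data.Bool.Properties using (¬-not; not-involutive; xor-same; xor-comm)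
open import Data.Empty using (⊥; ⊥-elim)
import Data.Integer as ℤ
open import Data.List using (List; []; _∷_; _++_; map; foldr; length; filterᵇ)
open import Data.List.Membership.Propositional using (_∈_; find; lose)
open import Data.List.Membership.Propositional.Properties using (∈-map⁺; ∈-map⁻)
open import Data.List.Properties using (length-++; length-map)
open import Data.List.Relation.Unary.All as All using (All; []; _∷_; universal)
open import Data.List.Relation.Unary.All.Properties using (++⁺; map⁺)
open import Data.List.Relation.Unary.AllPairs using ([]; _∷_)
open import Data.List.Relation.Unary.Any using (here; there; any?)
open import Data.List.Relation.Unary.Unique.Propositional using (Unique)
open import Data.Nat as ℕ using (ℕ; zero; suc; _^_)
open import Data.Nat.Logarithm using (⌊log₂_⌋; ⌊log₂⌋-mono-≤; ⌊log₂[2^n]⌋≡n)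
import Data.Nat.Properties as ℕₚ
import Data.Nat.Solver as ℕSolver
open import Data.Product as Product using (∃; _×_; _,_; proj₁; proj₂)
open import Data.Rational as ℚ using (ℚ; 0ℚ; 1ℚ)
import Data.Rational.Properties as ℚₚ
import Data.Rational.Solver as ℚSolver
open import Data.Sum using (_⊎_; inj₁; inj₂; [_,_])
open import Function using (_∘_)
open import Relation.Binary.PropositionalEquality
  using (_≡_; refl; sym; trans; cong; cong₂; subst; subst₂)
open import Relation.Nullary using (¬_; Dec; yes; no; does; contradiction)
open import Relation.Nullary.Decidable using (_×-dec_; toWitness)

-- Counting, and cuts of diamond graphs

count : ∀ {A : Set} → (A → Bool) → List A → ℕ
count p xs = length (filterᵇ p xs)

module HardCuts where

  import Data.Bool as Bool
  open import Data.Nat using (_+_; _*_; _≤_; z≤n; s≤s)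
  open import Data.Nat.Properties

  count-++ : ∀ {A : Set} (p : A → Bool) xs ys → count p (xs ++ ys) ≡ count p xs + count p ys
  count-++ p []       ys = refl
  count-++ p (x ∷ xs) ys with p x
  ... | true  = cong suc (count-++ p xs ys)
  ... | false = count-++ p xs ys

  count-map : ∀ {A B : Set} (p : B → Bool) (q : A → Bool) (f : A → B) →
    (∀ x → p (f x) ≡ q x) → ∀ xs → count p (map f xs) ≡ count q xs
  count-map p q f eq []       = refl
  count-map p q f eq (x ∷ xs) rewrite eq x with q x
  ... | true  = cong suc (count-map p q f eq xs)
  ... | false = count-map p q f eq xs

  count-cong : ∀ {A : Set} {p q : A → Bool} → (∀ x → p x ≡ q x) → ∀ xs → count p xs ≡ count q xs
  count-cong eq []       = refl
  count-cong {q = q} eq (x ∷ xs) rewrite eq x with q x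
  ... | true  = cong suc (count-cong eq xs)
  ... | false = count-cong eq xs

  count-none : ∀ {A : Set} {p : A → Bool} → (∀ x → p x ≡ false) → ∀ xs → count p xs ≡ 0
  count-none none []       = refl
  count-none none (x ∷ xs) rewrite none x = count-none none xs

  module _ {k : ℕ} where

    cut-cong : ∀ {C C′ : Subset (D k)} → (∀ v → C v ≡ C′ v) → cut (D k) C ≡ cut (D k) C′
    cut-cong eq = count-cong (λ { (u , v) → cong₂ _xor_ (eq u) (eq v) }) (diamondEdges k)

    cut-constant : ∀ {C : Subset (D k)} b → (∀ v → C v ≡ b) → cut (D k) C ≡ 0
    cut-constant b eq = count-none
      (λ { (u , v) → trans (cong₂ _xor_ (eq u) (eq v)) (xor-same b) }) (diamondEdges k)

  opposite : Side → Side
  opposite left  = right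
  opposite right = left

  -- The edges of `D (suc k)` are those of its four copies. The grouping anticipates the hard cut:
  -- the first two quarters, on the routes through different middle vertices, are treated
  -- recursively, the last two are joined by new demand.
  cut-quarters : ∀ {k} a (C : Subset (D (suc k))) → cut (D (suc k)) C ≡
    (cut (D k) (C ∘ place (a , far)) + cut (D k) (C ∘ place (opposite a , near))) +
    (cut (D k) (C ∘ place (a , near)) + cut (D k) (C ∘ place (opposite a , far)))
  cut-quarters {k} a C = trans listed (arrange a)
    where
    open ℕSolver.+-*-Solver
    part : Side × Half → ℕ
    part q = cut (D k) (C ∘ place q)
    E = diamondEdges k
    crossing : ∀ q rest {f : Vertex k × Vertex k → Vertex (suc k) × Vertex (suc k)} →
      (∀ u v → f (u , v) ≡ (place q u , place q v)) →
      count (crosses (D (suc k)) C) (map f E ++ rest) ≡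
      part q + count (crosses (D (suc k)) C) rest
    crossing q rest {f} eq = trans (count-++ _ (map f E) rest)
      (cong (_+ count (crosses (D (suc k)) C) rest)
        (count-map _ _ f (λ { (u , v) → cong (crosses (D (suc k)) C) (eq u v) }) E))
    listed : cut (D (suc k)) C ≡
      part (left , near) + (part (left , far) + (part (right , near) + (part (right , far) + 0)))
    listed =
      trans (crossing (left , near) _ λ _ _ → refl) (cong (part (left , near) +_)
      (trans (crossing (left , far) _ λ _ _ → refl) (cong (part (left , far) +_)
      (trans (crossing (right , near) _ λ _ _ → refl) (cong (part (right , near) +_)
      (crossing (right , far) [] λ _ _ → refl))))))
    arrange : ∀ a →
      part (left , near) + (part (left , far) + (part (right , near) + (part (right , far) + 0))) ≡
      (part (a , far) + part (opposite a , near)) + (part (a , near) + part (opposite a , far))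
    arrange left = solve 4 (λ w x y z → w :+ (x :+ (y :+ (z :+ con 0))) := (x :+ y) :+ (w :+ z))
      refl (part (left , near)) (part (left , far)) (part (right , near)) (part (right , far))
    arrange right = solve 4 (λ w x y z → w :+ (x :+ (y :+ (z :+ con 0))) := (z :+ w) :+ (y :+ x))
      refl (part (left , near)) (part (left , far)) (part (right , near)) (part (right , far))

  -- Quartet splits, linked pairs and demand between linked copies

  Apart : ∀ {V : Set} → V → V → V → V → (V → Bool) → Set
  Apart a b c d C = C b ≡ C a × C c ≡ not (C a) × C d ≡ not (C a)

  apart? : ∀ {V : Set} (a b c d : V) (C : V → Bool) → Dec (Apart a b c d C)
  apart? a b c d C = (C b Bool.≟ C a) ×-dec (C c Bool.≟ not (C a)) ×-dec (C d Bool.≟ not (C a))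

  -- When 𝒞 is read as the tree of its members, this says that the tree paths
  -- from a to b and from c to d meet.
  Linked : ∀ {V : Set} → List (V → Bool) → V → V → V → V → Set
  Linked 𝒞 a b c d = ∀ {C} → C ∈ 𝒞 → ¬ Apart a b c d C

  linked? : ∀ {V : Set} (𝒞 : List (V → Bool)) a b c d →
    Linked 𝒞 a b c d ⊎ ∃ λ C → C ∈ 𝒞 × Apart a b c d C
  linked? 𝒞 a b c d with any? (apart? a b c d) 𝒞
  ... | yes p = inj₂ (find p)
  ... | no ¬p = inj₁ λ C∈ apart → ¬p (lose C∈ apart)

  linked-sym : ∀ {V : Set} {𝒞 : List (V → Bool)} {a b c d} → Linked 𝒞 a b c d → Linked 𝒞 c d a b
  linked-sym {a = a} {c = c} linked {C} C∈ (d≡c , a≡¬c , b≡¬c) =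
    linked C∈ (trans b≡¬c (sym a≡¬c) , c≡¬a , trans d≡c c≡¬a)
    where
    c≡¬a : C c ≡ not (C a)
    c≡¬a = trans (sym (not-involutive (C c))) (cong not (sym a≡¬c))

  -- A quarter on the left and a quarter on the right share no edge, whichever halves they are.
  quarters-≤-cut : ∀ {j} (h h′ : Half) (C : Subset (D (suc j))) →
    cut (D j) (C ∘ place (left , h)) + cut (D j) (C ∘ place (right , h′)) ≤ cut (D (suc j)) C
  quarters-≤-cut {j} h h′ C = ≤-trans (bound h h′) (≤-reflexive (sym (cut-quarters left C)))
    where
    LN = cut (D j) (C ∘ place (left , near))
    LF = cut (D j) (C ∘ place (left , far))
    RN = cut (D j) (C ∘ place (right , near))
    RF = cut (D j) (C ∘ place (right , far))
    bound : ∀ h h′ → cut (D j) (C ∘ place (left , h)) + cut (D j) (C ∘ place (right , h′)) ≤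
      (LF + RN) + (LN + RF)
    bound near near = ≤-trans (≤-reflexive (+-comm LN RN)) (+-mono-≤ (m≤n+m RN LF) (m≤m+n LN RF))
    bound near far  = m≤n+m (LN + RF) (LF + RN)
    bound far  near = m≤m+n (LF + RN) (LN + RF)
    bound far  far  = +-mono-≤ (m≤m+n LF RN) (m≤n+m RF LN)

  separated-by : ∀ {A V : Set} (f g : A → V) → (V → Bool) → A × A → Bool
  separated-by f g C (u , v) = C (f u) xor C (g v)

  module _ {k : ℕ} {𝒞 : List (Subset (D k))} (laminar : Laminar (D k) 𝒞) where

    non-crossing : ∀ {A B p q r} → A ∈ 𝒞 → B ∈ 𝒞 → A p ≡ true → B p ≡ true →
      A q ≡ true → B q ≡ false → A r ≡ false → B r ≡ true → ⊥
    non-crossing A∈ B∈ Ap Bp Aq Bq Ar Br with laminar A∈ B∈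
    ... | inj₁ disjoint      = contradiction (trans (sym Bp) (disjoint _ Ap)) λ ()
    ... | inj₂ (inj₁ A⊑B) = contradiction (trans (sym (A⊑B _ Aq)) Bq) λ ()
    ... | inj₂ (inj₂ B⊑A) = contradiction (trans (sym (B⊑A _ Br)) Ar) λ ()

    -- The points `p`, `q`, `r`, `w` lie one in each of the four regions cut out by `A` and `B`.
    -- Whichever region holds `p`, the points in `A` and `B`, in `A` only and in `B` only show that
    -- the two sets cross. The hypotheses are relative to `p`, so complementing `A` or `B` makes no
    -- difference.
    some-corner-empty : ∀ {A B p q r w} → A ∈ 𝒞 → B ∈ 𝒞 →
      A q ≡ A p → B q ≡ not (B p) →
      A r ≡ not (A p) → B r ≡ B p →
      A w ≡ not (A p) → B w ≡ not (B p) → ⊥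
    some-corner-empty {A} {B} {p} A∈ B∈ Aq Bq Ar Br Aw Bw
      with A p in Ap | B p in Bp
    ... | true  | true  = non-crossing A∈ B∈ Ap Bp Aq Bq Ar Br
    ... | true  | false = non-crossing A∈ B∈ Aq Bq Ap Bp Aw Bw
    ... | false | true  = non-crossing A∈ B∈ Ar Br Aw Bw Ap Bp
    ... | false | false = non-crossing A∈ B∈ Aw Bw Ar Br Aq Bq

    -- The four-point property of trees: a member splitting `a`, `b` from `c`, `d` and a member
    -- splitting `a`, `c` from `b`, `d` would cross.
    four-point : ∀ a b c d → Linked 𝒞 a b c d ⊎ Linked 𝒞 a c b d
    four-point a b c d with linked? 𝒞 a b c d | linked? 𝒞 a c b d
    ... | inj₁ linked | _           = inj₁ linked
    ... | inj₂ _      | inj₁ linked = inj₂ linked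
    ... | inj₂ (A , A∈ , Ab , Ac , Ad) | inj₂ (B , B∈ , Bc , Bb , Bd) =
      ⊥-elim (some-corner-empty A∈ B∈ Ab Bb Ac Bc Ad Bd)

    -- In the tree, the path from `a` to `b` is covered by the paths from `a` to `x` and from `x` to
    -- `b`, so one of these meets the path from `c` to `d`. Otherwise let `A` split `a`, `x` from
    -- `c`, `d` and `B` split `x`, `b` from `c`, `d`. By `linked`, `A` must cut off `b` from `a` and
    -- `B` must cut off `a` from `b`, so `x`, `a`, `b`, `c` fill all four regions.
    linked-split : ∀ {a b c d} x → Linked 𝒞 a b c d → Linked 𝒞 a x c d ⊎ Linked 𝒞 x b c d
    linked-split {a} {b} {c} {d} x linked with linked? 𝒞 a x c d | linked? 𝒞 x b c d
    ... | inj₁ ax | _       = inj₁ ax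
    ... | inj₂ _  | inj₁ xb = inj₂ xb
    ... | inj₂ (A , A∈ , Ax , Ac , Ad) | inj₂ (B , B∈ , Bb , Bc , Bd) =
      ⊥-elim (some-corner-empty {p = x} {q = a} {r = b} {w = c} A∈ B∈
        (sym Ax)
        (¬-not λ Ba → linked B∈ (trans Bb (sym Ba) , trans Bc (cong not (sym Ba)) , trans Bd (cong not (sym Ba))))
        (trans (¬-not λ Ab → linked A∈ (Ab , Ac , Ad)) (cong not (sym Ax)))
        Bb (trans Ac (cong not (sym Ax))) Bc)

    quarter-linked : ∀ {j} (f : Vertex (suc j) → Vertex k) {c d} a → Linked 𝒞 (f s) (f t) c d →
      ∃ λ h → Linked 𝒞 (f (place (a , h) s)) (f (place (a , h) t)) c d
    quarter-linked f a linked with linked-split (f (inner (mid a))) linked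
    ... | inj₁ l = near , l
    ... | inj₂ l = far , l

    -- Each side of the two copies contains a pair of linked quarters, so recursing on both sides
    -- doubles the number of pairs at every level. A member pays for the left pairs with edges of
    -- left quarters and for the right pairs with edges of right quarters, so no edge pays twice.
    bridge : ∀ {j} (f g : Vertex j → Vertex k) → Linked 𝒞 (f s) (f t) (g s) (g t) →
      ∃ λ Q → length Q ≡ 2 ^ j ×
        (∀ {C} → C ∈ 𝒞 → count (separated-by f g C) Q ≤ cut (D j) (C ∘ f) + cut (D j) (C ∘ g))
    -- Each copy is now a single edge. A member that separates the two sources but crosses neither
    -- edge would be `Apart`, which `linked` excludes.
    bridge {zero} f g linked = (s , s) ∷ [] , refl , λ {C} C∈ → bound C (linked C∈)
      where
      bound : ∀ C → ¬ Apart (f s) (f t) (g s) (g t) C →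
        count (separated-by f g C) ((s , s) ∷ []) ≤ cut (D 0) (C ∘ f) + cut (D 0) (C ∘ g)
      bound C ¬apart with C (f s) | C (f t) | C (g s) | C (g t)
      ... | true  | _     | true  | _     = z≤n
      ... | false | _     | false | _     = z≤n
      ... | true  | false | false | _     = s≤s z≤n
      ... | false | true  | true  | _     = s≤s z≤n
      ... | true  | true  | false | true  = s≤s z≤n
      ... | false | false | true  | false = s≤s z≤n
      ... | true  | true  | false | false = contradiction (refl , refl , refl) ¬apart
      ... | false | false | true  | true  = contradiction (refl , refl , refl) ¬apart
    bridge {suc j} f g linked = pairs left ++ pairs right , size , λ {C} C∈ → begin
      count (separated-by f g C) (pairs left ++ pairs right)
        ≡⟨ count-++ _ (pairs left) (pairs right) ⟩
      count (separated-by f g C) (pairs left) + count (separated-by f g C) (pairs right)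
        ≡⟨ cong₂ _+_ (pulled left C) (pulled right C) ⟩
      count (sub left C) (sub-pairs left) + count (sub right C) (sub-pairs right)
        ≤⟨ +-mono-≤ (proj₂ (proj₂ (proj₂ (half left))) C∈) (proj₂ (proj₂ (proj₂ (half right))) C∈) ⟩
      (cf left C + cg left C) + (cf right C + cg right C)
        ≡⟨ solve 4 (λ w x y z → (w :+ x) :+ (y :+ z) := (w :+ y) :+ (x :+ z)) refl
             (cf left C) (cg left C) (cf right C) (cg right C) ⟩
      (cf left C + cf right C) + (cg left C + cg right C)
        ≤⟨ +-mono-≤ (quarters-≤-cut (proj₁ (proj₁ (half left))) (proj₁ (proj₁ (half right))) (C ∘ f))
                    (quarters-≤-cut (proj₂ (proj₁ (half left))) (proj₂ (proj₁ (half right))) (C ∘ g)) ⟩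
      cut (D (suc j)) (C ∘ f) + cut (D (suc j)) (C ∘ g) ∎
      where
      open ≤-Reasoning
      open ℕSolver.+-*-Solver using (solve; _:+_; _:=_)
      half : ∀ a → ∃ λ ((h , h′) : Half × Half) → ∃ λ Q → length Q ≡ 2 ^ j ×
        (∀ {C} → C ∈ 𝒞 → count (separated-by (f ∘ place (a , h)) (g ∘ place (a , h′)) C) Q ≤
          cut (D j) (C ∘ f ∘ place (a , h)) + cut (D j) (C ∘ g ∘ place (a , h′)))
      -- First the copy `f` is narrowed to a quarter still linked to the whole of `g`; then, by
      -- symmetry, `g` is narrowed to a quarter linked to that one.
      half a with quarter-linked f a linked
      ... | h , linked₁ with quarter-linked g a (linked-sym linked₁)
      ... | h′ , linked₂ =
        (h , h′) , bridge (f ∘ place (a , h)) (g ∘ place (a , h′)) (linked-sym linked₂)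
      sub-pairs : Side → List (Vertex j × Vertex j)
      sub-pairs a = proj₁ (proj₂ (half a))
      fₐ gₐ : Side → Vertex j → Vertex (suc j)
      fₐ a = place (a , proj₁ (proj₁ (half a)))
      gₐ a = place (a , proj₂ (proj₁ (half a)))
      pairs : Side → List (Vertex (suc j) × Vertex (suc j))
      pairs a = map (Product.map (fₐ a) (gₐ a)) (sub-pairs a)
      sub : Side → Subset (D k) → Vertex j × Vertex j → Bool
      sub a = separated-by (f ∘ fₐ a) (g ∘ gₐ a)
      cf cg : Side → Subset (D k) → ℕ
      cf a C = cut (D j) (C ∘ f ∘ fₐ a)
      cg a C = cut (D j) (C ∘ g ∘ gₐ a)
      pulled : ∀ a C → count (separated-by f g C) (pairs a) ≡ count (sub a C) (sub-pairs a)
      pulled a C = count-map _ _ _ (λ _ → refl) (sub-pairs a)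
      size : length (pairs left ++ pairs right) ≡ 2 ^ suc j
      size = trans (length-++ (pairs left)) (cong₂ _+_
        (trans (length-map _ (sub-pairs left)) (proj₁ (proj₂ (proj₂ (half left)))))
        (trans (length-map _ (sub-pairs right)) (trans (proj₁ (proj₂ (proj₂ (half right)))) (sym (+-identityʳ _)))))

  -- The recursive cut and its demand pairs

  laminar-pullback : ∀ {j k} (f : Vertex j → Vertex k) {𝒞} → Laminar (D k) 𝒞 →
    Laminar (D j) (map (_∘ f) 𝒞)
  laminar-pullback f laminar A∈ B∈ with ∈-map⁻ (_∘ f) A∈ | ∈-map⁻ (_∘ f) B∈
  ... | A , A∈𝒞 , refl | B , B∈𝒞 , refl with laminar A∈𝒞 B∈𝒞
  ... | inj₁ disjoint   = inj₁ (disjoint ∘ f)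
  ... | inj₂ (inj₁ A⊑B) = inj₂ (inj₁ (A⊑B ∘ f))
  ... | inj₂ (inj₂ B⊑A) = inj₂ (inj₂ (B⊑A ∘ f))

  -- The demand looks harmless to the family, yet it exceeds the capacity of `S` by the factor
  -- `k / 2`. The conditions on `s` and `t` let cuts of neighbouring copies agree at shared
  -- vertices; `size` is doubled to avoid division.
  record HardCut (k : ℕ) (𝒞 : List (Subset (D k))) : Set where
    field
      S         : Subset (D k)
      s∈S       : S s ≡ true
      t∉S       : S t ≡ false
      cut-S     : cut (D k) S ≡ 2 ^ k
      pairs     : List (Vertex k × Vertex k)
      separated : All (λ (u , v) → S u ≡ true × S v ≡ false) pairs
      size      : 2 * length pairs ≡ k * 2 ^ k
      respects  : ∀ {C} → C ∈ 𝒞 → count (crosses (D k) C) pairs ≤ cut (D k) C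

  -- Only the values of `g` at inner vertices are read; the terminals of the copies get theirs from
  -- `s`, `t` and `m`.
  glue : ∀ {k} → (Side → Bool) → (Side × Half → Subset (D k)) → Subset (D (suc k))
  glue m g s                  = true
  glue m g t                  = false
  glue m g (inner (mid a))    = m a
  glue m g (inner (copy q v)) = g q (inner v)

  -- By `four-point` on the four corners, for one side `a` the copy from `s` to `mid a` is linked to
  -- the copy from the other middle vertex to `t`. These two are bridged; the other two recurse.
  hard-cut : ∀ k {𝒞} → Laminar (D k) 𝒞 → HardCut k 𝒞
  hard-cut zero laminar = record
    { S         = λ { s → true ; t → false ; (inner _) → false }
    ; s∈S       = refl
    ; t∉S       = refl
    ; cut-S     = refl
    ; pairs     = []
    ; separated = []
    ; size      = refl
    ; respects  = λ _ → z≤n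
    }
  hard-cut (suc k) {𝒞} laminar = [ assemble left , assemble right ]
    (four-point laminar s (inner (mid left)) (inner (mid right)) t)
    where
    -- With `mid a` inside `S` and `mid b` outside, the bridged copies `near-a` and `far-b` lie
    -- wholly inside and wholly outside: they add no capacity, but all their `2 ^ k` pairs cross.
    -- The copies `far-a` and `near-b` each run from a vertex in `S` to one outside, so their
    -- recursive cuts fit and add `2 ^ k` each.
    assemble : ∀ a → Linked 𝒞 s (inner (mid a)) (inner (mid (opposite a))) t → HardCut (suc k) 𝒞
    assemble a linked = record
      { S         = S
      ; s∈S       = refl
      ; t∉S       = refl
      ; cut-S     = cut-S
      ; pairs     = map (both far-a) (pairs H₁) ++ map (both near-b) (pairs H₂) ++ map across Q
      ; separated = ++⁺ (map⁺ (All.map (Product.map (trans (S-far-a _)) (trans (S-far-a _))) (separated H₁)))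
                   (++⁺ (map⁺ (All.map (Product.map (trans (S-near-b _)) (trans (S-near-b _))) (separated H₂)))
                        (map⁺ (universal (λ (u , v) → S-near-a u , S-far-b v) Q)))
      ; size      = size′
      ; respects  = respects′
      }
      where
      open HardCut hiding (S; cut-S)
      b = opposite a
      near-a far-a near-b far-b : Vertex k → Vertex (suc k)
      near-a = place (a , near)
      far-a  = place (a , far)
      near-b = place (b , near)
      far-b  = place (b , far)
      both : (Vertex k → Vertex (suc k)) → Vertex k × Vertex k → Vertex (suc k) × Vertex (suc k)
      both f = Product.map f f
      across : Vertex k × Vertex k → Vertex (suc k) × Vertex (suc k)
      across = Product.map near-a far-b
      bridged = bridge laminar near-a far-b linked
      Q = proj₁ bridged
      H₁ = hard-cut k (laminar-pullback far-a laminar)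
      H₂ = hard-cut k (laminar-pullback near-b laminar)
      S : Subset (D (suc k))
      S = glue (λ c → does (c ≟ˢ a)) λ
        { (c , near) v → if does (c ≟ˢ a) then true else HardCut.S H₂ v
        ; (c , far)  v → if does (c ≟ˢ a) then HardCut.S H₁ v else false }
      a≟a : ∀ a → does (a ≟ˢ a) ≡ true
      a≟a left  = refl
      a≟a right = refl
      b≟a : ∀ a → does (opposite a ≟ˢ a) ≡ false
      b≟a left  = refl
      b≟a right = refl
      S-near-a : ∀ v → S (near-a v) ≡ true
      S-near-a s         = refl
      S-near-a t         = a≟a a
      S-near-a (inner v) rewrite a≟a a = refl
      S-far-a : ∀ v → S (far-a v) ≡ HardCut.S H₁ v
      S-far-a s         = trans (a≟a a) (sym (s∈S H₁))
      S-far-a t         = sym (t∉S H₁)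
      S-far-a (inner v) rewrite a≟a a = refl
      S-near-b : ∀ v → S (near-b v) ≡ HardCut.S H₂ v
      S-near-b s         = sym (s∈S H₂)
      S-near-b t         = trans (b≟a a) (sym (t∉S H₂))
      S-near-b (inner v) rewrite b≟a a = refl
      S-far-b : ∀ v → S (far-b v) ≡ false
      S-far-b s         = b≟a a
      S-far-b t         = refl
      S-far-b (inner v) rewrite b≟a a = refl
      cut-S : cut (D (suc k)) S ≡ 2 ^ suc k
      cut-S = trans (cut-quarters a S) (trans (cong₂ _+_
        (cong₂ _+_ (trans (cut-cong S-far-a) (HardCut.cut-S H₁)) (trans (cut-cong S-near-b) (HardCut.cut-S H₂)))
        (cong₂ _+_ (cut-constant true S-near-a) (cut-constant false S-far-b)))
        (+-assoc (2 ^ k) (2 ^ k) 0))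
      size′ : 2 * length (map (both far-a) (pairs H₁) ++ map (both near-b) (pairs H₂) ++ map across Q) ≡
        suc k * 2 ^ suc k
      size′ = begin-equality
        2 * length (map (both far-a) (pairs H₁) ++ map (both near-b) (pairs H₂) ++ map across Q)
          ≡⟨ cong (2 *_) (trans (length-++ (map (both far-a) (pairs H₁)))
               (cong₂ _+_ (length-map _ (pairs H₁)) (trans (length-++ (map (both near-b) (pairs H₂)))
                 (cong₂ _+_ (length-map _ (pairs H₂)) (trans (length-map _ Q) (proj₁ (proj₂ bridged))))))) ⟩
        2 * (length (pairs H₁) + (length (pairs H₂) + 2 ^ k))
          ≡⟨ solve 3 (λ x y z → con 2 :* (x :+ (y :+ z)) := (con 2 :* x :+ con 2 :* y) :+ con 2 :* z)
               refl (length (pairs H₁)) (length (pairs H₂)) (2 ^ k) ⟩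
        (2 * length (pairs H₁) + 2 * length (pairs H₂)) + 2 * 2 ^ k
          ≡⟨ cong (_+ 2 * 2 ^ k) (cong₂ _+_ (size H₁) (size H₂)) ⟩
        (k * 2 ^ k + k * 2 ^ k) + 2 * 2 ^ k
          ≡⟨ solve 2 (λ k z → (k :* z :+ k :* z) :+ con 2 :* z := (con 1 :+ k) :* (con 2 :* z)) refl k (2 ^ k) ⟩
        suc k * 2 ^ suc k ∎
        where
        open ≤-Reasoning
        open ℕSolver.+-*-Solver
      respects′ : ∀ {C} → C ∈ 𝒞 → count (crosses (D (suc k)) C)
        (map (both far-a) (pairs H₁) ++ map (both near-b) (pairs H₂) ++ map across Q) ≤ cut (D (suc k)) C
      respects′ {C} C∈ = begin
        count (crosses (D (suc k)) C)
          (map (both far-a) (pairs H₁) ++ map (both near-b) (pairs H₂) ++ map across Q)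
          ≡⟨ trans (count-++ _ (map (both far-a) (pairs H₁)) _) (cong₂ _+_
               (count-map _ _ _ (λ _ → refl) (pairs H₁))
               (trans (count-++ _ (map (both near-b) (pairs H₂)) _) (cong₂ _+_
                 (count-map _ _ _ (λ _ → refl) (pairs H₂))
                 (count-map _ _ _ (λ _ → refl) Q)))) ⟩
        count (crosses (D k) (C ∘ far-a)) (pairs H₁) +
          (count (crosses (D k) (C ∘ near-b)) (pairs H₂) + count (separated-by near-a far-b C) Q)
          -- Each of the four quarters is charged once: two by the recursive pairs, two by the
          -- bridge.
          ≤⟨ +-mono-≤ (respects H₁ (∈-map⁺ (_∘ far-a) C∈))
               (+-mono-≤ (respects H₂ (∈-map⁺ (_∘ near-b) C∈)) (proj₂ (proj₂ bridged) C∈)) ⟩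
        cut (D k) (C ∘ far-a) + (cut (D k) (C ∘ near-b) +
          (cut (D k) (C ∘ near-a) + cut (D k) (C ∘ far-b)))
          ≡⟨ +-assoc (cut (D k) (C ∘ far-a)) (cut (D k) (C ∘ near-b)) _ ⟨
        (cut (D k) (C ∘ far-a) + cut (D k) (C ∘ near-b)) +
          (cut (D k) (C ∘ near-a) + cut (D k) (C ∘ far-b))
          ≡⟨ cut-quarters a C ⟨
        cut (D (suc k)) C ∎
        where open ≤-Reasoning

-- Rational arithmetic and finite sums

module Flows where

  open import Data.Rational hiding (_⊔_; _≟_)
  open import Data.Rational.Properties hiding (_≟_)
  open import Data.Nat using (_⊔_)
  open ℚSolver.+-*-Solver using (solve; _:+_; _:*_; _:-_; :-_; _:=_; con)

  ⟦_⟧ : ℕ → ℚ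
  ⟦ n ⟧ = ℤ.+ n / 1

  ⟦1+_⟧ : ∀ n → ⟦ suc n ⟧ ≡ 1ℚ + ⟦ n ⟧
  ⟦1+ n ⟧ = trans (suc-/ n 0) (+-comm ⟦ n ⟧ 1ℚ)

  ⟦⟧-+ : ∀ m n → ⟦ m ℕ.+ n ⟧ ≡ ⟦ m ⟧ + ⟦ n ⟧
  ⟦⟧-+ zero    n = sym (+-identityˡ ⟦ n ⟧)
  ⟦⟧-+ (suc m) n = trans ⟦1+ m ℕ.+ n ⟧ (trans (cong (1ℚ +_) (⟦⟧-+ m n))
    (trans (sym (+-assoc 1ℚ ⟦ m ⟧ ⟦ n ⟧)) (cong (_+ ⟦ n ⟧) (sym ⟦1+ m ⟧))))

  ⟦⟧-* : ∀ m n → ⟦ m ℕ.* n ⟧ ≡ ⟦ m ⟧ * ⟦ n ⟧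
  ⟦⟧-* zero    n = sym (*-zeroˡ ⟦ n ⟧)
  ⟦⟧-* (suc m) n = trans (⟦⟧-+ n (m ℕ.* n)) (trans
    (cong₂ _+_ (sym (*-identityˡ ⟦ n ⟧)) (⟦⟧-* m n))
    (trans (sym (*-distribʳ-+ ⟦ n ⟧ 1ℚ ⟦ m ⟧)) (cong (_* ⟦ n ⟧) (sym ⟦1+ m ⟧))))

  ⟦⟧-mono : ∀ {m n} → m ℕ.≤ n → ⟦ m ⟧ ≤ ⟦ n ⟧
  ⟦⟧-mono {m} {n} m≤n = /-mono m n 0 0 (ℕₚ.*-monoˡ-≤ 1 m≤n)

  sum : ∀ {A : Set} → List A → (A → ℚ) → ℚ
  sum xs g = foldr _+_ 0ℚ (map g xs)

  module _ {A : Set} where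

    sum-cong : ∀ {g h : A → ℚ} → (∀ x → g x ≡ h x) → ∀ xs → sum xs g ≡ sum xs h
    sum-cong eq []       = refl
    sum-cong eq (x ∷ xs) = cong₂ _+_ (eq x) (sum-cong eq xs)

    sum-mono : ∀ {g h : A → ℚ} → (∀ x → g x ≤ h x) → ∀ xs → sum xs g ≤ sum xs h
    sum-mono le []       = ≤-refl
    sum-mono le (x ∷ xs) = +-mono-≤ (le x) (sum-mono le xs)

    sum-+ : ∀ (g h : A → ℚ) xs → sum xs (λ x → g x + h x) ≡ sum xs g + sum xs h
    sum-+ g h []       = refl
    sum-+ g h (x ∷ xs) = trans (cong (g x + h x +_) (sum-+ g h xs))
      (solve 4 (λ a b c d → (a :+ b) :+ (c :+ d) := (a :+ c) :+ (b :+ d)) refl (g x) (h x) (sum xs g) (sum xs h))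

    sum-* : ∀ c (g : A → ℚ) xs → sum xs (λ x → c * g x) ≡ c * sum xs g
    sum-* c g []       = sym (*-zeroʳ c)
    sum-* c g (x ∷ xs) = trans (cong (c * g x +_) (sum-* c g xs)) (sym (*-distribˡ-+ c (g x) (sum xs g)))

    sum-0 : ∀ (xs : List A) → sum xs (λ _ → 0ℚ) ≡ 0ℚ
    sum-0 []       = refl
    sum-0 (x ∷ xs) = trans (+-identityˡ _) (sum-0 xs)

    sum≥0 : ∀ {g : A → ℚ} → (∀ x → 0ℚ ≤ g x) → ∀ xs → 0ℚ ≤ sum xs g
    sum≥0 0≤g xs = subst (_≤ sum xs _) (sum-0 xs) (sum-mono 0≤g xs)

    ∣sum∣≤ : ∀ (g : A → ℚ) xs → ∣ sum xs g ∣ ≤ sum xs (∣_∣ ∘ g)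
    ∣sum∣≤ g []       = ≤-refl
    ∣sum∣≤ g (x ∷ xs) = ≤-trans (∣p+q∣≤∣p∣+∣q∣ (g x) (sum xs g)) (+-monoʳ-≤ ∣ g x ∣ (∣sum∣≤ g xs))

  sum-swap : ∀ {A B : Set} (h : A → B → ℚ) xs ys →
    sum xs (λ x → sum ys (h x)) ≡ sum ys (λ y → sum xs (λ x → h x y))
  sum-swap h []       ys = sym (sum-0 ys)
  sum-swap h (x ∷ xs) ys = trans (cong (sum ys (h x) +_) (sum-swap h xs ys))
    (sym (sum-+ (h x) (λ y → sum xs (λ x → h x y)) ys))

  ι : Bool → ℚ
  ι true  = 1ℚ
  ι false = 0ℚ

  module _ {A : Set} where

    sum-ι : ∀ (p : A → Bool) xs → sum xs (ι ∘ p) ≡ ⟦ count p xs ⟧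
    sum-ι p []       = refl
    sum-ι p (x ∷ xs) with p x
    ... | true  = trans (cong (1ℚ +_) (sum-ι p xs)) (sym ⟦1+ count p xs ⟧)
    ... | false = trans (+-identityˡ _) (sum-ι p xs)

    sum-filter : ∀ (p : A → Bool) (g : A → ℚ) xs → sum (filterᵇ p xs) g ≡ sum xs (λ x → ι (p x) * g x)
    sum-filter p g []       = refl
    sum-filter p g (x ∷ xs) with p x
    ... | true  = cong₂ _+_ (sym (*-identityˡ (g x))) (sum-filter p g xs)
    ... | false = trans (sum-filter p g xs) (sym (trans (cong (_+ rest) (*-zeroˡ (g x))) (+-identityˡ rest)))
      where rest = sum xs (λ x → ι (p x) * g x)

  -- Demands given by lists of vertex pairs

  module PairDemand (G : Graph) where
    open Graph G

    [_≐_] : V → V → ℚ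
    [ u ≐ v ] = ι (does (u ≟ v))

    sum-≐-absent : ∀ {a xs} (g : V → ℚ) → All (λ x → ¬ (x ≡ a)) xs → sum xs (λ v → [ v ≐ a ] * g v) ≡ 0ℚ
    sum-≐-absent g [] = refl
    sum-≐-absent {a} {x ∷ xs} g (x≢a ∷ rest) with x ≟ a
    ... | yes x≡a = contradiction x≡a x≢a
    ... | no _    = trans (cong₂ _+_ (*-zeroˡ (g x)) (sum-≐-absent g rest)) (+-identityˡ 0ℚ)

    sum-≐-unique : ∀ {a xs} (g : V → ℚ) → a ∈ xs → Unique xs → sum xs (λ v → [ v ≐ a ] * g v) ≡ g a
    sum-≐-unique {a} {x ∷ xs} g a∈ (x∉ ∷ uniq) with x ≟ a | a∈
    ... | yes refl | _ = trans (cong₂ _+_ (*-identityˡ (g a))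
        (sum-≐-absent g (All.map (λ ≢x → ≢x ∘ sym) x∉))) (+-identityʳ (g a))
    ... | no x≢a | here a≡x  = contradiction (sym a≡x) x≢a
    ... | no _   | there a∈′ = trans (cong₂ _+_ (*-zeroˡ (g x)) (sum-≐-unique g a∈′ uniq)) (+-identityˡ (g a))

    -- Every vertex is listed exactly once, so the indicator of `a` selects a single term.
    sum-≐ : ∀ a (g : V → ℚ) → sum vertices (λ v → [ v ≐ a ] * g v) ≡ g a
    sum-≐ a g = sum-≐-unique g (complete a) unique

    ∑-seq : ∀ vs (g : V → ℝ) m → seq (∑ G vs g) m ≡ sum vs (λ v → seq (g v) m)
    ∑-seq []       g m = refl
    ∑-seq (v ∷ vs) g m = cong (seq (g v) m +_) (∑-seq vs g m)

    -- Each pair is one unit to be sent from its first vertex to its second; units at a common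
    -- vertex may cancel.
    pairDemand : List (V × V) → V → ℚ
    pairDemand P v = sum P (λ (a , b) → [ v ≐ a ] - [ v ≐ b ])

    -- Exchanging the sums evaluates the demand against a potential `x` pair by pair. The constant
    -- potential shows that the total vanishes; the indicator of a set gives the demand of that set.
    sum-pairDemand : ∀ P (x : V → ℚ) → sum vertices (λ v → x v * pairDemand P v) ≡ sum P (λ (a , b) → x a - x b)
    sum-pairDemand P x = begin-equality
      sum vertices (λ v → x v * pairDemand P v)
        ≡⟨ sum-cong (λ v → sym (sum-* (x v) _ P)) vertices ⟩
      sum vertices (λ v → sum P (λ (a , b) → x v * ([ v ≐ a ] - [ v ≐ b ])))
        ≡⟨ sum-swap _ vertices P ⟩
      sum P (λ (a , b) → sum vertices (λ v → x v * ([ v ≐ a ] - [ v ≐ b ])))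
        ≡⟨ sum-cong (λ (a , b) → difference a b) P ⟩
      sum P (λ (a , b) → x a - x b) ∎
      where
      open ≤-Reasoning
      difference : ∀ a b → sum vertices (λ v → x v * ([ v ≐ a ] - [ v ≐ b ])) ≡ x a - x b
      difference a b = begin-equality
        sum vertices (λ v → x v * ([ v ≐ a ] - [ v ≐ b ]))
          ≡⟨ sum-cong (λ v → solve 3 (λ x p q → x :* (p :- q) := p :* x :+ q :* (:- x)) refl
               (x v) [ v ≐ a ] [ v ≐ b ]) vertices ⟩
        sum vertices (λ v → [ v ≐ a ] * x v + [ v ≐ b ] * (- x v))
          ≡⟨ sum-+ (λ v → [ v ≐ a ] * x v) (λ v → [ v ≐ b ] * (- x v)) vertices ⟩
        sum vertices (λ v → [ v ≐ a ] * x v) + sum vertices (λ v → [ v ≐ b ] * (- x v))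
          ≡⟨ cong₂ _+_ (sum-≐ a x) (sum-≐ b (-_ ∘ x)) ⟩
        x a - x b ∎

    demand : List (V × V) → V → ℝ
    demand P v = fromℚ (pairDemand P v)

    demand-isDemand : ∀ P → IsDemand G (demand P)
    demand-isDemand P ε 0<ε = 0 , λ n _ → ≤-trans (≤-reflexive (cong (λ q → ∣ q - 0ℚ ∣) (vanishes n))) (<⇒≤ 0<ε)
      where
      vanishes : ∀ n → seq (∑ G vertices (demand P)) n ≡ 0ℚ
      vanishes n = trans (∑-seq vertices (demand P) n)
        (trans (sum-cong (λ v → sym (*-identityˡ (pairDemand P v))) vertices)
        (trans (sum-pairDemand P (λ _ → 1ℚ)) (sum-0 P)))

    seq-total : ∀ P C m → seq (total G (demand P) C) m ≡ sum P (λ (a , b) → ι (C a) - ι (C b))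
    seq-total P C m = trans (∑-seq (filterᵇ C vertices) (demand P) m)
      (trans (sum-filter C (pairDemand P) vertices) (sum-pairDemand P (ι ∘ C)))

    ∣ι-ι∣ : ∀ p q → ∣ ι p - ι q ∣ ≡ ι (p xor q)
    ∣ι-ι∣ true  true  = refl
    ∣ι-ι∣ true  false = refl
    ∣ι-ι∣ false true  = refl
    ∣ι-ι∣ false false = refl

    -- A pair contributes to the demand of `C`, with absolute value 1, only when `C` separates its
    -- ends.
    demand-respects : ∀ P 𝒞 → (∀ {C} → C ∈ 𝒞 → count (crosses G C) P ℕ.≤ cut G C) → RespectsCuts G 𝒞 (demand P)
    demand-respects P 𝒞 bound {C} C∈ ε 0<ε = 0 , λ n _ → begin
      ∣ seq (total G (demand P) C) n ∣                ≡⟨ cong ∣_∣ (seq-total P C n) ⟩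
      ∣ sum P (λ (a , b) → ι (C a) - ι (C b)) ∣       ≤⟨ ∣sum∣≤ _ P ⟩
      sum P (λ (a , b) → ∣ ι (C a) - ι (C b) ∣)       ≡⟨ sum-cong (λ (a , b) → ∣ι-ι∣ (C a) (C b)) P ⟩
      sum P (ι ∘ crosses G C)                        ≡⟨ sum-ι (crosses G C) P ⟩
      ⟦ count (crosses G C) P ⟧                       ≤⟨ ⟦⟧-mono (bound C∈) ⟩
      ⟦ cut G C ⟧                                     ≡⟨ +-identityʳ ⟦ cut G C ⟧ ⟨
      ⟦ cut G C ⟧ + 0ℚ                                ≤⟨ +-monoʳ-≤ ⟦ cut G C ⟧ (<⇒≤ 0<ε) ⟩
      ⟦ cut G C ⟧ + ε                                 ∎
      where open ≤-Reasoning

    -- All pairs point out of `S`, so nothing cancels.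
    separated-size : ∀ (S : V → Bool) {P : List (V × V)} → All (λ (u , v) → S u ≡ true × S v ≡ false) P →
      sum P (λ (a , b) → ι (S a) - ι (S b)) ≡ ⟦ length P ⟧
    separated-size S []                 = refl
    separated-size S {_ ∷ P} ((u∈ , v∉) ∷ rest) = trans
      (cong₂ _+_ (cong₂ (λ p q → ι p - ι q) u∈ v∉) (separated-size S rest)) (sym ⟦1+ length P ⟧)

    -- The sum runs over ordered pairs of vertices, so each edge crossing `S` appears in both
    -- orientations; hence the two copies of the cut.
    weighted-sum-cap : ∀ (S : V → Bool) → sum vertices (λ u → sum vertices (λ v → ι (S u xor S v) * ⟦ cap G u v ⟧)) ≤
      ⟦ cut G S ⟧ + ⟦ cut G S ⟧
    weighted-sum-cap S = begin
      sum vertices (λ u → sum vertices (λ v → ι (S u xor S v) * ⟦ cap G u v ⟧))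
        ≤⟨ sum-mono (λ u → sum-mono (λ v → entry u v) vertices) vertices ⟩
      sum vertices (λ u → sum vertices (λ v → sum edges (λ e → weight e u v)))
        ≡⟨ sum-cong (λ u → sum-swap _ vertices edges) vertices ⟩
      sum vertices (λ u → sum edges (λ e → sum vertices (weight e u)))
        ≡⟨ sum-swap _ vertices edges ⟩
      sum edges (λ e → sum vertices (λ u → sum vertices (weight e u)))
        ≡⟨ sum-cong (λ (a , b) → edge a b) edges ⟩
      sum edges (λ e → ι (crosses G S e) + ι (crosses G S e))
        ≡⟨ sum-+ _ _ edges ⟩
      sum edges (ι ∘ crosses G S) + sum edges (ι ∘ crosses G S)
        ≡⟨ cong₂ _+_ (sum-ι (crosses G S) edges) (sum-ι (crosses G S) edges) ⟩
      ⟦ cut G S ⟧ + ⟦ cut G S ⟧ ∎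
      where
      open ≤-Reasoning
      X : V → V → ℚ
      X u v = ι (S u xor S v)
      weight : V × V → V → V → ℚ
      weight (a , b) u v = [ u ≐ a ] * ([ v ≐ b ] * X u v) + [ u ≐ b ] * ([ v ≐ a ] * X u v)
      -- The Booleans are independent here, so both orientations may hold at once; this is why only
      -- an inequality is claimed.
      joined : ∀ x p q r z → ι x * ι ((p ∧ q) ∨ (r ∧ z)) ≤ ι p * (ι q * ι x) + ι r * (ι z * ι x)
      joined false p     q     r     z     = ≤-reflexive (trans (*-zeroˡ (ι ((p ∧ q) ∨ (r ∧ z)))) (sym (solve 4
        (λ p q r z → p :* (q :* con 0ℚ) :+ r :* (z :* con 0ℚ) := con 0ℚ) refl (ι p) (ι q) (ι r) (ι z))))
      joined true  false q     false z     = ≤-reflexive (sym (cong₂ _+_ (*-zeroˡ (ι q * 1ℚ)) (*-zeroˡ (ι z * 1ℚ))))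
      joined true  false q     true  true  = ≤-reflexive (sym (cong (_+ 1ℚ) (*-zeroˡ (ι q * 1ℚ))))
      joined true  false q     true  false = ≤-reflexive (sym (cong (_+ 0ℚ) (*-zeroˡ (ι q * 1ℚ))))
      joined true  true  false false z     = ≤-reflexive (sym (cong (0ℚ +_) (*-zeroˡ (ι z * 1ℚ))))
      joined true  true  false true  true  = ≤-refl
      joined true  true  false true  false = ≤-refl
      joined true  true  true  false z     = ≤-reflexive (sym (cong (1ℚ +_) (*-zeroˡ (ι z * 1ℚ))))
      joined true  true  true  true  true  = toWitness {a? = _ ≤? _} _
      joined true  true  true  true  false = ≤-refl
      entry : ∀ u v → X u v * ⟦ cap G u v ⟧ ≤ sum edges (λ e → weight e u v)
      entry u v = begin
        X u v * ⟦ cap G u v ⟧                          ≡⟨ cong (X u v *_) (sum-ι (joins G u v) edges) ⟨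
        X u v * sum edges (ι ∘ joins G u v)            ≡⟨ sum-* (X u v) _ edges ⟨
        sum edges (λ e → X u v * ι (joins G u v e))
          ≤⟨ sum-mono (λ (a , b) → joined (S u xor S v) (does (u ≟ a)) (does (v ≟ b)) (does (u ≟ b)) (does (v ≟ a))) edges ⟩
        sum edges (λ e → weight e u v)                 ∎
      at : ∀ a b → sum vertices (λ u → sum vertices (λ v → [ u ≐ a ] * ([ v ≐ b ] * X u v))) ≡ X a b
      at a b = trans (sum-cong (λ u → trans (sum-* [ u ≐ a ] _ vertices) (cong ([ u ≐ a ] *_) (sum-≐ b (X u)))) vertices)
        (sum-≐ a (λ u → X u b))
      edge : ∀ a b → sum vertices (λ u → sum vertices (weight (a , b) u)) ≡
        ι (crosses G S (a , b)) + ι (crosses G S (a , b))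
      edge a b = trans (trans
        (sum-cong (λ u → sum-+ _ _ vertices) vertices) (sum-+ _ _ vertices))
        (cong₂ _+_ (at a b) (trans (at b a) (cong ι (xor-comm (S b) (S a)))))

  -- From real inequalities to rational ones with an error

  Eventually : (ℕ → Set) → Set
  Eventually P = ∃ λ N → ∀ n → N ℕ.≤ n → P n

  _∧ᵉ_ : ∀ {P Q} → Eventually P → Eventually Q → Eventually (λ n → P n × Q n)
  (M , p) ∧ᵉ (N , q) = M ⊔ N , λ n n≥ →
    p n (ℕₚ.m⊔n≤o⇒m≤o M N n≥) , q n (ℕₚ.m⊔n≤o⇒n≤o M N n≥)

  -- Finitely many thresholds have a maximum. This gives one index from which all the flow
  -- conditions hold together.
  eventually-all : ∀ {A : Set} {P : A → ℕ → Set} → (∀ x → Eventually (P x)) →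
    ∀ xs → Eventually (λ n → ∀ {x} → x ∈ xs → P x n)
  eventually-all ev []       = 0 , λ _ _ ()
  eventually-all ev (x ∷ xs) with ev x ∧ᵉ eventually-all ev xs
  ... | N , p = N , λ { n n≥ (here refl) → proj₁ (p n n≥) ; n n≥ (there x∈) → proj₂ (p n n≥) x∈ }

  p≤∣p∣ : ∀ p → p ≤ ∣ p ∣
  p≤∣p∣ p with ≤-total 0ℚ p
  ... | inj₁ 0≤p = ≤-reflexive (sym (0≤p⇒∣p∣≡p 0≤p))
  ... | inj₂ p≤0 = ≤-trans p≤0 (0≤∣p∣ p)

  -p≤∣p∣ : ∀ p → - p ≤ ∣ p ∣
  -p≤∣p∣ p = subst (- p ≤_) (∣-p∣≡∣p∣ p) (p≤∣p∣ (- p))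

  ∣p-q∣≤ε⇒p≤q+ε : ∀ p q {ε} → ∣ p - q ∣ ≤ ε → p ≤ q + ε
  ∣p-q∣≤ε⇒p≤q+ε p q {ε} close = begin
    p           ≡⟨ solve 2 (λ p q → p := q :+ (p :- q)) refl p q ⟩
    q + (p - q) ≤⟨ +-monoʳ-≤ q (≤-trans (p≤∣p∣ (p - q)) close) ⟩
    q + ε       ∎
    where
    open ≤-Reasoning

  -- f and f′ are the flows along u v and along v u; p and q say whether u and v lie in the cut.
  crossing-flow : ∀ {f f′ Ac η} p q → 0ℚ ≤ η → f ≤ - f′ + η → f′ ≤ - f + η → ∣ f ∣ ≤ Ac + η →
    ι p * f + ι q * f′ ≤ ι (p xor q) * Ac + (η + η)
  crossing-flow {f} {f′} {Ac} {η} true true 0≤η f≤ f′≤ ∣f∣≤ = begin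
    1ℚ * f + 1ℚ * f′                ≡⟨ cong₂ _+_ (*-identityˡ f) (*-identityˡ f′) ⟩
    f + f′                          ≤⟨ +-monoˡ-≤ f′ f≤ ⟩
    (- f′ + η) + f′                 ≡⟨ solve 2 (λ g h → (:- g :+ h) :+ g := h) refl f′ η ⟩
    η                               ≡⟨ +-identityʳ η ⟨
    η + 0ℚ                          ≤⟨ +-monoʳ-≤ η 0≤η ⟩
    η + η                           ≡⟨ +-identityˡ (η + η) ⟨
    0ℚ + (η + η)                    ≡⟨ cong (_+ (η + η)) (*-zeroˡ Ac) ⟨
    0ℚ * Ac + (η + η)               ∎
    where open ≤-Reasoning
  crossing-flow {f} {f′} {Ac} {η} true false 0≤η f≤ f′≤ ∣f∣≤ = begin
    1ℚ * f + 0ℚ * f′                ≡⟨ cong₂ _+_ (*-identityˡ f) (*-zeroˡ f′) ⟩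
    f + 0ℚ                          ≤⟨ +-mono-≤ (≤-trans (p≤∣p∣ f) ∣f∣≤) 0≤η ⟩
    (Ac + η) + η                    ≡⟨ +-assoc Ac η η ⟩
    Ac + (η + η)                    ≡⟨ cong (_+ (η + η)) (*-identityˡ Ac) ⟨
    1ℚ * Ac + (η + η)               ∎
    where open ≤-Reasoning
  crossing-flow {f} {f′} {Ac} {η} false true 0≤η f≤ f′≤ ∣f∣≤ = begin
    0ℚ * f + 1ℚ * f′                ≡⟨ cong₂ _+_ (*-zeroˡ f) (*-identityˡ f′) ⟩
    0ℚ + f′                         ≡⟨ +-identityˡ f′ ⟩
    f′                              ≤⟨ f′≤ ⟩
    - f + η                         ≤⟨ +-monoˡ-≤ η (≤-trans (-p≤∣p∣ f) ∣f∣≤) ⟩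
    (Ac + η) + η                    ≡⟨ +-assoc Ac η η ⟩
    Ac + (η + η)                    ≡⟨ cong (_+ (η + η)) (*-identityˡ Ac) ⟨
    1ℚ * Ac + (η + η)               ∎
    where open ≤-Reasoning
  crossing-flow {f} {f′} {Ac} {η} false false 0≤η f≤ f′≤ ∣f∣≤ = begin
    0ℚ * f + 0ℚ * f′                ≡⟨ cong₂ _+_ (*-zeroˡ f) (*-zeroˡ f′) ⟩
    0ℚ + 0ℚ                         ≤⟨ +-monoʳ-≤ 0ℚ (+-mono-≤ 0≤η 0≤η) ⟩
    0ℚ + (η + η)                    ≡⟨ cong (_+ (η + η)) (*-zeroˡ Ac) ⟨
    0ℚ * Ac + (η + η)               ∎
    where open ≤-Reasoning

  -- The flow across a cut

  module _ (G : Graph) where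
    open Graph G
    open PairDemand G

    -- With N vertices this is N(N+1): one error `η` for each ordered pair of vertices, from
    -- antisymmetry and congestion, and one for each vertex, from routing.
    slack : ℚ
    slack = sum vertices (λ _ → sum vertices (λ _ → 1ℚ) + 1ℚ)

    slack≥0 : 0ℚ ≤ slack
    slack≥0 = sum≥0 (λ _ → +-mono-≤ (sum≥0 (λ _ → nonNegative⁻¹ 1ℚ) vertices) (nonNegative⁻¹ 1ℚ)) vertices

    -- A real flow seen at a single index of its Cauchy sequences, where its conditions hold only up
    -- to `η`.
    module RationalFlow (F : V → V → ℚ) (d : V → ℚ) (A η : ℚ) (0≤A : 0ℚ ≤ A) (0≤η : 0ℚ ≤ η)
      (anti  : ∀ u v → F u v ≤ - F v u + η)
      (route : ∀ v → d v ≤ sum vertices (F v) + η)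
      (congested : ∀ u v → ∣ F u v ∣ ≤ A * ⟦ cap G u v ⟧ + η)
      where

      term : ∀ (S : V → Bool) u v → ι (S u) * F u v + ι (S v) * F v u ≤
        A * (ι (S u xor S v) * ⟦ cap G u v ⟧) + (η + η)
      term S u v = ≤-trans
        (crossing-flow (S u) (S v) 0≤η (anti u v) (anti v u) (congested u v))
        (≤-reflexive (cong (_+ (η + η)) (commute (ι (S u xor S v)) ⟦ cap G u v ⟧)))
        where
        commute : ∀ x c → x * (A * c) ≡ A * (x * c)
        commute x c = solve 3 (λ x a c → x :* (a :* c) := a :* (x :* c)) refl x A c

      -- Adding to F u v its reverse F v u cancels, up to η, the flow inside S.
      flow-bound : ∀ (S : V → Bool) → sum vertices (λ v → ι (S v) * d v) ≤ A * ⟦ cut G S ⟧ + slack * η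
      flow-bound S = *-cancelˡ-≤-pos (1ℚ + 1ℚ) (begin
        (1ℚ + 1ℚ) * sum vertices (λ v → ι (S v) * d v)
          ≤⟨ *-monoˡ-≤-nonNeg (1ℚ + 1ℚ) (sum-mono vertex vertices) ⟩
        (1ℚ + 1ℚ) * sum vertices (λ u → sum vertices (λ v → ι (S u) * F u v) + η)
          ≡⟨ cong ((1ℚ + 1ℚ) *_) (sum-+ _ _ vertices) ⟩
        (1ℚ + 1ℚ) * (out + sum vertices (λ _ → η))
          ≡⟨ solve 2 (λ o h → (con 1ℚ :+ con 1ℚ) :* (o :+ h) := (o :+ o) :+ (h :+ h)) refl out (sum vertices (λ _ → η)) ⟩
        (out + out) + (Ση + Ση)
          -- Exchanging the sums in one of the two copies of `out` places `F v u` next to `F u v`.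
          ≡⟨ cong (_+ (Ση + Ση)) (cong (out +_) (sum-swap _ vertices vertices)) ⟩
        (out + sum vertices (λ u → sum vertices (λ v → ι (S v) * F v u))) + (Ση + Ση)
          ≡⟨ cong (_+ (Ση + Ση)) (sum₂-+ _ _) ⟨
        sum₂ (λ u v → ι (S u) * F u v + ι (S v) * F v u) + (Ση + Ση)
          ≤⟨ +-monoˡ-≤ (Ση + Ση) (sum-mono (λ u → sum-mono (term S u) vertices) vertices) ⟩
        sum₂ (λ u v → A * (ι (S u xor S v) * ⟦ cap G u v ⟧) + (η + η)) + (Ση + Ση)
          ≡⟨ cong (_+ (Ση + Ση)) (trans (sum₂-+ _ _) (cong₂ _+_ scale (sum₂-+ _ _))) ⟩
        (A * sum₂ (λ u v → ι (S u xor S v) * ⟦ cap G u v ⟧) + (ΣΣη + ΣΣη)) + (Ση + Ση)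
          ≤⟨ +-monoˡ-≤ (Ση + Ση) (+-monoˡ-≤ (ΣΣη + ΣΣη)
               (*-monoˡ-≤-nonNeg A {{nonNegative 0≤A}} (weighted-sum-cap S))) ⟩
        (A * (⟦ cut G S ⟧ + ⟦ cut G S ⟧) + (ΣΣη + ΣΣη)) + (Ση + Ση)
          ≡⟨ solve 4 (λ a c x y → (a :* (c :+ c) :+ (x :+ x)) :+ (y :+ y) :=
               (con 1ℚ :+ con 1ℚ) :* (a :* c :+ (x :+ y))) refl A ⟦ cut G S ⟧ ΣΣη Ση ⟩
        (1ℚ + 1ℚ) * (A * ⟦ cut G S ⟧ + (ΣΣη + Ση))
          ≡⟨ cong (λ e → (1ℚ + 1ℚ) * (A * ⟦ cut G S ⟧ + e)) slack-eq ⟩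
        (1ℚ + 1ℚ) * (A * ⟦ cut G S ⟧ + slack * η) ∎)
        where
        open ≤-Reasoning
        sum₂ : (V → V → ℚ) → ℚ
        sum₂ h = sum vertices (λ u → sum vertices (h u))
        sum₂-+ : ∀ g h → sum₂ (λ u v → g u v + h u v) ≡ sum₂ g + sum₂ h
        sum₂-+ g h = trans (sum-cong (λ u → sum-+ (g u) (h u) vertices) vertices) (sum-+ _ _ vertices)
        out = sum₂ (λ u v → ι (S u) * F u v)
        Ση = sum vertices (λ _ → η)
        ΣΣη = sum₂ (λ _ _ → η)
        scale : sum₂ (λ u v → A * (ι (S u xor S v) * ⟦ cap G u v ⟧)) ≡
          A * sum₂ (λ u v → ι (S u xor S v) * ⟦ cap G u v ⟧)
        scale = trans (sum-cong (λ u → sum-* A _ vertices) vertices) (sum-* A _ vertices)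
        const-η : ∀ {B : Set} (xs : List B) → η * sum xs (λ _ → 1ℚ) ≡ sum xs (λ _ → η)
        const-η xs = trans (sym (sum-* η _ xs)) (sum-cong (λ _ → *-identityʳ η) xs)
        slack-eq : ΣΣη + Ση ≡ slack * η
        slack-eq = trans (sym (sum-+ _ _ vertices)) (trans
          (sum-cong (λ _ → trans (cong₂ _+_ (sym (const-η vertices)) (sym (*-identityʳ η)))
            (sym (*-distribˡ-+ η (sum vertices (λ _ → 1ℚ)) 1ℚ))) vertices)
          (trans (sum-* η _ vertices) (*-comm η slack)))
        vertex : ∀ v → ι (S v) * d v ≤ sum vertices (λ w → ι (S v) * F v w) + η
        vertex v = ≤-trans (weigh (S v)) (≤-reflexive (cong (_+ η) (sym (sum-* (ι (S v)) (F v) vertices))))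
          where
          weigh : ∀ b → ι b * d v ≤ ι b * sum vertices (F v) + η
          weigh true  = subst₂ _≤_ (sym (*-identityˡ (d v))) (cong (_+ η) (sym (*-identityˡ (sum vertices (F v))))) (route v)
          weigh false = subst₂ _≤_ (trans (+-identityˡ 0ℚ) (sym (*-zeroˡ (d v))))
            (cong (_+ η) (sym (*-zeroˡ (sum vertices (F v))))) (+-monoʳ-≤ 0ℚ 0≤η)

    -- Weak duality: every unit of the demand leaves `S`, and the edges across the cut carry at most
    -- `α` times their capacity.
    routable⇒bound : ∀ S P α → All (λ (u , v) → S u ≡ true × S v ≡ false) P →
      1ᴿ ≤ᴿ α → Routable G (demand P) α → fromℕ (length P) ≤ᴿ α *ᴿ fromℕ (cut G S)
    routable⇒bound S P α separated 1≤α (f , (anti , _) , routes , congested) ε 0<ε = proj₁ good , bound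
      where
      open ≤-Reasoning
      -- Chosen so that `(slack + 1ℚ) * η` equals `ε`; the added `1ℚ` makes the divisor positive.
      tolerance = scaled (slack + 1ℚ) (nonNeg+pos⇒pos (slack) {{nonNegative slack≥0}} 1ℚ) ε 0<ε
      η = proj₁ tolerance
      0<η = proj₁ (proj₂ tolerance)
      everywhere : ∀ {Q : V → ℕ → Set} → (∀ v → Eventually (Q v)) → Eventually (λ n → ∀ v → Q v n)
      everywhere ev = proj₁ (eventually-all ev vertices) ,
        λ n n≥ v → proj₂ (eventually-all ev vertices) n n≥ (complete v)
      Close : ℕ → Set
      Close n = (∀ u v → ∣ seq (f u v) n - (- seq (f v u) n) ∣ ≤ η)
        × (∀ v → ∣ seq (∑ G vertices (f v)) n - pairDemand P v ∣ ≤ η)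
        × (∀ u v → ∣ seq (f u v) n ∣ ≤ seq α n * ⟦ cap G u v ⟧ + η)
        × 1ℚ ≤ seq α n + 1ℚ
      good : Eventually Close
      good = (everywhere λ u → everywhere λ v → anti u v η 0<η)
        ∧ᵉ ((everywhere λ v → routes v η 0<η)
        ∧ᵉ ((everywhere λ u → everywhere λ v → congested u v η 0<η)
        -- Taking the error 1 in `1≤α` leaves `seq α n` nonnegative, which multiplying the capacity
        -- bound by it requires.
        ∧ᵉ 1≤α 1ℚ (positive⁻¹ 1ℚ)))
      conclude : ∀ n → Close n → ⟦ length P ⟧ ≤ seq α n * ⟦ cut G S ⟧ + ε
      conclude n (anti-n , routes-n , congested-n , α≥0) = begin
        ⟦ length P ⟧                                      ≡⟨ separated-size S separated ⟨
        sum P (λ (a , b) → ι (S a) - ι (S b))             ≡⟨ sum-pairDemand P (ι ∘ S) ⟨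
        sum vertices (λ v → ι (S v) * pairDemand P v)     ≤⟨ Index.flow-bound S ⟩
        seq α n * ⟦ cut G S ⟧ + slack * η                 ≤⟨ +-monoʳ-≤ (seq α n * ⟦ cut G S ⟧) within ⟩
        seq α n * ⟦ cut G S ⟧ + ε                         ∎
        where
        F : V → V → ℚ
        F u v = seq (f u v) n
        outflow : ∀ v → ∣ pairDemand P v - sum vertices (F v) ∣ ≤ η
        outflow v = subst (_≤ η) (trans (cong (λ q → ∣ q - pairDemand P v ∣) (∑-seq vertices (f v) n))
          (∣p-q∣≡∣q-p∣ (sum vertices (F v)) (pairDemand P v))) (routes-n v)
        module Index = RationalFlow F (pairDemand P) (seq α n) η
          (subst₂ _≤_ (+-inverseʳ 1ℚ) (solve 1 (λ a → a :+ con 1ℚ :+ con (- 1ℚ) := a) refl (seq α n))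
            (+-monoˡ-≤ (- 1ℚ) α≥0))
          (<⇒≤ 0<η)
          (λ u v → ∣p-q∣≤ε⇒p≤q+ε (F u v) (- F v u) (anti-n u v))
          (λ v → ∣p-q∣≤ε⇒p≤q+ε (pairDemand P v) (sum vertices (F v)) (outflow v))
          congested-n
        within : slack * η ≤ ε
        within = ≤-trans
          (*-monoʳ-≤-nonNeg η {{nonNegative (<⇒≤ 0<η)}}
            (subst (_≤ slack + 1ℚ) (+-identityʳ (slack)) (+-monoʳ-≤ (slack) (nonNegative⁻¹ 1ℚ))))
          (≤-reflexive (proj₂ (proj₂ tolerance)))
      bound : ∀ n → proj₁ good ℕ.≤ n → ⟦ length P ⟧ ≤ seq α n * ⟦ cut G S ⟧ + ε
      bound n n≥ = conclude n (proj₂ good n n≥)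

-- Comparison with the logarithm

open import Data.Nat using (_≤_)
open HardCuts
open Flows
open ℚSolver.+-*-Solver using (solve; _:+_; _:*_; _:=_; con)

log₂-seq-≤ : ∀ n b m → n ≤ 2 ^ b → log₂-seq n m ℚ.≤ ⟦ b ⟧
log₂-seq-≤ n b m n≤2^b = /-mono ⌊log₂ (n ^ suc m) ⌋ b m 0 (begin
  ⌊log₂ (n ^ suc m) ⌋ ℕ.* 1        ≡⟨ ℕₚ.*-identityʳ _ ⟩
  ⌊log₂ (n ^ suc m) ⌋              ≤⟨ ⌊log₂⌋-mono-≤ (ℕₚ.^-monoˡ-≤ (suc m) n≤2^b) ⟩
  ⌊log₂ ((2 ^ b) ^ suc m) ⌋        ≡⟨ cong ⌊log₂_⌋ (ℕₚ.^-*-assoc 2 b (suc m)) ⟩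
  ⌊log₂ (2 ^ (b ℕ.* suc m)) ⌋      ≡⟨ ⌊log₂[2^n]⌋≡n (b ℕ.* suc m) ⟩
  b ℕ.* suc m                      ∎)
  where open ℕₚ.≤-Reasoning

-- The upper bound on `n` is `2 ^ (2k + 3)`, and `2k + 3 ≤ 5k` once `k` is at least 1. For `k = 0`
-- it reads `n < 8`, against the hypothesis.
floor-≤ : ∀ n k → 8 ≤ n → IsFloorLog₄Half n k → n ≤ 2 ^ (5 ℕ.* k)
floor-≤ n zero    8≤n (_ , n<) = contradiction 8≤n (ℕₚ.<⇒≱ n<)
floor-≤ n (suc k) 8≤n (_ , n<) = begin
  n                             ≤⟨ ℕₚ.<⇒≤ n< ⟩
  2 ℕ.* 4 ^ suc (suc k)         ≡⟨ cong (2 ℕ.*_) (ℕₚ.^-*-assoc 2 2 (suc (suc k))) ⟩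
  2 ^ suc (2 ℕ.* suc (suc k))   ≤⟨ ℕₚ.^-monoʳ-≤ 2 (begin
    suc (2 ℕ.* suc (suc k))
      ≡⟨ NS.solve 1 (λ k → NS.con 1 NS.:+ NS.con 2 NS.:* (NS.con 2 NS.:+ k) NS.:= NS.con 2 NS.:* k NS.:+ NS.con 5) refl k ⟩
    2 ℕ.* k ℕ.+ 5               ≤⟨ ℕₚ.+-monoˡ-≤ 5 (ℕₚ.*-monoˡ-≤ k {2} {5} (ℕ.s≤s (ℕ.s≤s ℕ.z≤n))) ⟩
    5 ℕ.* k ℕ.+ 5               ≡⟨ ℕₚ.+-comm (5 ℕ.* k) 5 ⟩
    5 ℕ.+ 5 ℕ.* k               ≡⟨ ℕₚ.*-suc 5 k ⟨
    5 ℕ.* suc k                 ∎) ⟩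
  2 ^ (5 ℕ.* suc k)             ∎
  where
  open ℕₚ.≤-Reasoning
  module NS = ℕSolver.+-*-Solver

-- A half from the guarantee `k / 2`, times a fifth from `log₂ n ≤ 5k`.
1/10 : ℚ
1/10 = ℤ.+ 1 ℚ./ 10

⟦2^k⟧-pos : ∀ k → ℚ.Positive ⟦ 2 ^ k ⟧
⟦2^k⟧-pos k = ℚ.positive (ℚₚ.<-≤-trans (ℚₚ.positive⁻¹ 1ℚ) (⟦⟧-mono (ℕₚ.m^n>0 2 k)))

approximation-bound : ∀ k {𝒞 α} → Laminar (D k) 𝒞 → IsCongestionApproximator (D k) 𝒞 α →
  ∀ n → n ≤ 2 ^ (5 ℕ.* k) → fromℚ 1/10 *ᴿ log₂ n ≤ᴿ α
approximation-bound k {𝒞} {α} laminar (1≤α , approximates) n n≤ ε 0<ε =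
  proj₁ tight , λ m m≥ → ℚₚ.*-cancelʳ-≤-pos T {{⟦2^k⟧-pos k}} (begin
    1/10 ℚ.* log₂-seq n m ℚ.* T
      ≤⟨ ℚₚ.*-monoʳ-≤-nonNeg T {{ℚₚ.pos⇒nonNeg T {{⟦2^k⟧-pos k}}}}
           (ℚₚ.*-monoˡ-≤-nonNeg 1/10 (log₂-seq-≤ n (5 ℕ.* k) m n≤)) ⟩
    1/10 ℚ.* ⟦ 5 ℕ.* k ⟧ ℚ.* T        ≡⟨ demand-size ⟩
    ⟦ length pairs ⟧                  ≤⟨ proj₂ tight m m≥ ⟩
    seq α m ℚ.* ⟦ cut (D k) S ⟧ ℚ.+ T ℚ.* ε
      ≡⟨ cong (λ c → seq α m ℚ.* ⟦ c ⟧ ℚ.+ T ℚ.* ε) cut-S ⟩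
    seq α m ℚ.* T ℚ.+ T ℚ.* ε
      ≡⟨ solve 3 (λ a t e → a :* t :+ t :* e := (a :+ e) :* t) refl (seq α m) T ε ⟩
    (seq α m ℚ.+ ε) ℚ.* T             ∎)
  where
  open ℚₚ.≤-Reasoning
  open HardCut (hard-cut k laminar)
  open PairDemand (D k)
  T = ⟦ 2 ^ k ⟧
  demand-size : 1/10 ℚ.* ⟦ 5 ℕ.* k ⟧ ℚ.* T ≡ ⟦ length pairs ⟧
  demand-size = begin-equality
    1/10 ℚ.* ⟦ 5 ℕ.* k ⟧ ℚ.* T           ≡⟨ cong (λ x → 1/10 ℚ.* x ℚ.* T) (⟦⟧-* 5 k) ⟩
    1/10 ℚ.* (⟦ 5 ⟧ ℚ.* ⟦ k ⟧) ℚ.* T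
      ≡⟨ solve 2 (λ k t → con 1/10 :* (con ⟦ 5 ⟧ :* k) :* t := con ℚ.½ :* (k :* t)) refl ⟦ k ⟧ T ⟩
    ℚ.½ ℚ.* (⟦ k ⟧ ℚ.* T)                ≡⟨ cong (ℚ.½ ℚ.*_) (trans (sym (⟦⟧-* k (2 ^ k))) (trans (cong ⟦_⟧ (sym size)) (⟦⟧-* 2 (length pairs)))) ⟩
    ℚ.½ ℚ.* (⟦ 2 ⟧ ℚ.* ⟦ length pairs ⟧) ≡⟨ solve 1 (λ l → con ℚ.½ :* (con ⟦ 2 ⟧ :* l) := l) refl ⟦ length pairs ⟧ ⟩
    ⟦ length pairs ⟧                     ∎
  0<Tε : 0ℚ ℚ.< T ℚ.* ε
  0<Tε = ℚₚ.positive⁻¹ _ {{ℚₚ.pos*pos⇒pos T {{⟦2^k⟧-pos k}} ε {{ℚ.positive 0<ε}}}}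
  -- The error is `T ℚ.* ε` because the inequality is later divided by the capacity `T` of the cut.
  tight = routable⇒bound (D k) S pairs α separated 1≤α
    (approximates (demand pairs) (demand-isDemand pairs) (demand-respects pairs 𝒞 respects))
    (T ℚ.* ε) 0<Tε

corollary7 : ∃ λ (c : ℝ) → 0ᴿ <ᴿ c × (∃ λ (n₀ : ℕ) →
    ∀ (n k : ℕ) → 2 ≤ n → n₀ ≤ n → IsFloorLog₄Half n k →
    ∀ (𝒞 : List (Subset (D k))) (α : ℝ) →
    Laminar (D k) 𝒞 → IsCongestionApproximator (D k) 𝒞 α →
    c *ᴿ log₂ n ≤ᴿ α)
-- The threshold 8 is the least `n` for which `k` is positive.
corollary7 = fromℚ 1/10 , (1/10 , ℚₚ.positive⁻¹ 1/10 , 0 , λ _ _ → ℚₚ.≤-refl) , 8 ,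
  λ n k _ 8≤n floor 𝒞 α laminar approximator →
    approximation-bound k {𝒞} {α} laminar approximator n (floor-≤ n k 8≤n floor)
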